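{- The following decision problem (finite satisfiability of $\mathrm{FO}^2(\precsim_1,\precsim_2)$) is undecidable. Input: a two-variable first-order sentence $\varphi$ over a vocabulary consisting of the binary relation symbols $\precsim_1$, $\precsim_2$ and arbitrarily many unary relation symbols. Question: is there a finite structure with non-empty universe satisfying $\varphi$ in which both $\precsim_1$ and $\precsim_2$ are interpreted as total preorders?
   Context: Two-variable logic $\mathrm{FO}^2$ is first-order logic (with equality) restricted to formulas using at most the two variables $x$ and $y$ (which may be re-quantified). There is no bound on the number of unary relation symbols, and there are no other non-unary relation symbols than those listed. A total preorder is a transitive binary relation $\precsim$ such that for all $u,v$ one has $u\precsim v$ or $v\precsim u$ (in particular it is reflexive). -}

module Defs where

open import Level using (Level; 0ℓ)
open import Data.Bool using (Bool; true)
open import Data.Fin using (Fin; zero)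
open import Data.List using (List; []; _∷_; [_]; _++_; map; replicate)
open import Data.Nat using (ℕ; suc)
open import Data.Product using (Σ; ∃; _×_; _,_; proj₁)
open import Data.Sum using (_⊎_; inj₁; inj₂)
open import Function.Bundles using (_⇔_)
open import Relation.Binary using (Rel; Decidable; DecidableEquality; IsTotalPreorder)
open import Relation.Binary.PropositionalEquality using (_≡_; _≢_; refl)
open import Relation.Nullary using (¬_; yes; no)
open import Relation.Unary using (Pred) renaming (Decidable to Decidable₁)

------------------------------------------------------------------------
-- Two-variable formulas over ≾₁, ≾₂ and unary symbols

data Var : Set where
  x y : Var

_≟ᵛ_ : DecidableEquality Var
x ≟ᵛ x = yes refl
x ≟ᵛ y = no λ ()
y ≟ᵛ x = no λ ()
y ≟ᵛ y = yes refl

infix  8 _≾₁_ _≾₂_ _≐_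
infix  7 ~_
infixr 6 _∧_
infixr 5 _∨_
infixr 4 _⇒_

-- The unary symbols are numbered by ℕ. A formula mentions only finitely many of
-- them, and there is no bound on how many.
data Formula : Set where
  unary       : (i : ℕ) (v : Var) → Formula
  _≾₁_ _≾₂_   : (v w : Var) → Formula
  _≐_         : (v w : Var) → Formula
  ~_          : Formula → Formula
  _∧_ _∨_ _⇒_ : Formula → Formula → Formula
  all ex      : Var → Formula → Formula

_FreeIn_ : Var → Formula → Set
u FreeIn unary i v = u ≡ v
u FreeIn (v ≾₁ w)  = u ≡ v ⊎ u ≡ w
u FreeIn (v ≾₂ w)  = u ≡ v ⊎ u ≡ w
u FreeIn (v ≐ w)   = u ≡ v ⊎ u ≡ w
u FreeIn (~ φ)     = u FreeIn φ
u FreeIn (φ ∧ ψ)   = u FreeIn φ ⊎ u FreeIn ψ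
u FreeIn (φ ∨ ψ)   = u FreeIn φ ⊎ u FreeIn ψ
u FreeIn (φ ⇒ ψ)   = u FreeIn φ ⊎ u FreeIn ψ
u FreeIn (all v φ) = u ≢ v × u FreeIn φ
u FreeIn (ex v φ)  = u ≢ v × u FreeIn φ

Sentence : Set
Sentence = Σ Formula λ φ → ∀ v → ¬ (v FreeIn φ)

------------------------------------------------------------------------
-- Finite structures

-- Decidability of the relations is automatic classically; it makes these exactly
-- the finite structures given by finite tables. Symbols that do not occur in a
-- formula are interpreted too, which has no influence on its truth.
record FiniteStructure : Set₁ where
  field
    size-1 : ℕ

  Universe : Set
  Universe = Fin (suc size-1)

  field
    U   : ℕ → Pred Universe 0ℓ
    R₁  : Rel Universe 0ℓ
    R₂  : Rel Universe 0ℓ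
    U?  : ∀ i → Decidable₁ (U i)
    R₁? : Decidable R₁
    R₂? : Decidable R₂

module _ (𝔄 : FiniteStructure) where
  open FiniteStructure 𝔄

  Assignment : Set
  Assignment = Var → Universe

  _[_↦_] : Assignment → Var → Universe → Assignment
  (ρ [ v ↦ a ]) w with v ≟ᵛ w
  ... | yes _ = a
  ... | no  _ = ρ w

  Holds : Assignment → Formula → Set
  Holds ρ (unary i v) = U i (ρ v)
  Holds ρ (v ≾₁ w)    = R₁ (ρ v) (ρ w)
  Holds ρ (v ≾₂ w)    = R₂ (ρ v) (ρ w)
  Holds ρ (v ≐ w)     = ρ v ≡ ρ w
  Holds ρ (~ φ)       = ¬ Holds ρ φ
  Holds ρ (φ ∧ ψ)     = Holds ρ φ × Holds ρ ψ
  Holds ρ (φ ∨ ψ)     = Holds ρ φ ⊎ Holds ρ ψ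
  Holds ρ (φ ⇒ ψ)     = Holds ρ φ → Holds ρ ψ
  Holds ρ (all v φ)   = ∀ a → Holds (ρ [ v ↦ a ]) φ
  Holds ρ (ex v φ)    = ∃ λ a → Holds (ρ [ v ↦ a ]) φ

infix 3 _⊨_

-- For a sentence the choice of assignment is immaterial.
_⊨_ : FiniteStructure → Sentence → Set
𝔄 ⊨ (φ , _) = ∀ ρ → Holds 𝔄 ρ φ

FinitelySatisfiable : Sentence → Set₁
FinitelySatisfiable φ = ∃ λ (𝔄 : FiniteStructure) → let open FiniteStructure 𝔄 in
  IsTotalPreorder _≡_ R₁ × IsTotalPreorder _≡_ R₂ × (𝔄 ⊨ φ)

------------------------------------------------------------------------
-- Formulas as words over a fixed finite alphabet

data Letter : Set where
  𝕩 𝕪 𝕦 𝕝 𝟙 𝟚 eq neg conj disj imp univ exis : Letter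

varLetter : Var → Letter
varLetter x = 𝕩
varLetter y = 𝕪

-- Prefix notation, hence uniquely readable; the i-th unary symbol is the letter 𝕦
-- followed by i copies of 𝕝.
encode : Formula → List Letter
encode (unary i v) = 𝕦 ∷ replicate i 𝕝 ++ [ varLetter v ]
encode (v ≾₁ w)    = 𝟙 ∷ varLetter v ∷ varLetter w ∷ []
encode (v ≾₂ w)    = 𝟚 ∷ varLetter v ∷ varLetter w ∷ []
encode (v ≐ w)     = eq ∷ varLetter v ∷ varLetter w ∷ []
encode (~ φ)       = neg ∷ encode φ
encode (φ ∧ ψ)     = conj ∷ encode φ ++ encode ψ
encode (φ ∨ ψ)     = disj ∷ encode φ ++ encode ψ
encode (φ ⇒ ψ)     = imp ∷ encode φ ++ encode ψ
encode (all v φ)   = univ ∷ varLetter v ∷ encode φ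
encode (ex v φ)    = exis ∷ varLetter v ∷ encode φ

------------------------------------------------------------------------
-- Deterministic Turing machines with one two-way infinite tape

data Move : Set where
  left stay right : Move

data Action (Q Γ : Set) : Set where
  halt : (answer : Bool) → Action Q Γ
  next : (q : Q) (write : Γ) (m : Move) → Action Q Γ

-- The tape alphabet consists of the input letters, a blank and finitely many
-- auxiliary symbols.
record TuringMachine : Set where
  field
    #states #auxiliary : ℕ

  State : Set
  State = Fin #states

  TapeSymbol : Set
  TapeSymbol = Letter ⊎ Fin (suc #auxiliary)

  field
    start : State
    δ     : State → TapeSymbol → Action State TapeSymbol

  blank : TapeSymbol
  blank = inj₂ zero

module _ (M : TuringMachine) where
  open TuringMachine M

  -- The scanned symbol with the tape contents to its left (nearest cell first) and
  -- to its right. All cells beyond the ends of the lists are blank.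
  record Tape : Set where
    constructor tape
    field
      before  : List TapeSymbol
      scanned : TapeSymbol
      after   : List TapeSymbol

  move : Move → Tape → Tape
  move left  (tape []       a rs)       = tape [] blank (a ∷ rs)
  move left  (tape (l ∷ ls) a rs)       = tape ls l (a ∷ rs)
  move stay  t                          = t
  move right (tape ls       a [])       = tape (a ∷ ls) blank []
  move right (tape ls       a (r ∷ rs)) = tape (a ∷ ls) r rs

  write : TapeSymbol → Tape → Tape
  write b (tape ls a rs) = tape ls b rs

  initial : List Letter → Tape
  initial []      = tape [] blank []
  initial (a ∷ w) = tape [] (inj₁ a) (map inj₁ w)

  -- Run q t b: started in state q on tape t, the machine halts with answer b.
  data Run (q : State) (t : Tape) (b : Bool) : Set where
    halts : δ q (Tape.scanned t) ≡ halt b → Run q t b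
    steps : ∀ {q′ a m} → δ q (Tape.scanned t) ≡ next q′ a m →
            Run q′ (move m (write a t)) b → Run q t b

  HaltsWith : List Letter → Bool → Set
  HaltsWith w b = Run start (initial w) b

_Decides_ : ∀ {ℓ : Level} → TuringMachine → (Sentence → Set ℓ) → Set ℓ
M Decides P = ∀ φ → ∃ λ b → HaltsWith M (encode (proj₁ φ)) b × (b ≡ true ⇔ P φ)

Undecidable : ∀ {ℓ : Level} → (Sentence → Set ℓ) → Set ℓ
Undecidable P = ¬ (∃ λ M → M Decides P)

{-# OPTIONS --safe #-}

-- A machine M that decides the problem is confronted with a sentence φ that is
-- satisfiable exactly if M answers false on φ. A model of φ describes the computation of
-- M on φ itself. Its points on a "diagonal", the nodes, are linearly ordered by both
-- preorders; any other point is an arrow from the node in its ≾₁-class to the node in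
-- its ≾₂-class, and two variables suffice to compare the labels of these nodes. There
-- are three kinds of arrows, each a monotone bijection between two sets of nodes: S
-- leads to the next cell of a tape row, L to the same cell of the next row, and H matches
-- two parts of the first row. Since an S-arrow spans no node, L-arrows lead from
-- successive cells to successive cells, so that local constraints on labels force each
-- row to be the successor configuration of the previous one.
--
-- The first row has to contain the word of φ, hence a description of φ within φ. The
-- sentence is φ = ∀x ∀y ((turn x ⇒ follow w) ∧ body), where w is the word of body, and
-- body does not depend on w. The formula follow w walks along S-arrows and reads w letter
-- by letter. In prefix notation it is a sequence of gadgets, one for each letter of w, so
-- the word of φ consists of a constant, the gadgets for w, a constant, and w. The
-- labels describe such a word with unspecified letters, the H-arrows ensure that the
-- gadgets agree with the letters at the end, and follow w ensures that the latter are w.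

module Submission where

open import Defs
open import Data.Bool using (Bool; true; false; T) renaming (_∧_ to infixr 6 _&_)
import Data.Bool.Properties as Boolₚ
open import Data.Empty using (⊥; ⊥-elim)
open import Data.Fin as Fin using (Fin; toℕ; combine; quotient; remainder)
open import Data.Fin.Induction using (spo-noetherian)
import Data.Fin.Properties as Finₚ
open import Data.List using
  (List; []; _∷_; [_]; _++_; map; replicate; allFin; _ʳ++_; concatMap; cartesianProductWith;
   length; lookup; mapMaybe)
open import Data.List.Membership.Propositional using (_∈_)
open import Data.List.Membership.Propositional.Properties using
  (∈-++⁺ˡ; ∈-++⁺ʳ; ∈-map⁺; ∈-allFin; ∈-concatMap⁺; ∈-cartesianProductWith⁺)
import Data.List.Properties as Listₚ
open import Data.List.Relation.Unary.All as All using (All; []; _∷_)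
import Data.List.Relation.Unary.All.Properties as Allₚ
open import Data.List.Relation.Unary.Any as Any using (here; there; index)
open import Data.List.Relation.Unary.Any.Properties using (lookup-index)
open import Data.Maybe using (Maybe; just; nothing; Is-just)
import Data.Maybe.Properties as Maybeₚ
open import Data.Maybe.Properties using (just-injective)
open import Data.Maybe.Relation.Unary.Any using (just; dec)
open import Data.Nat as ℕ using (ℕ; zero; suc; _+_; _*_; _∸_)
open import Data.Nat.Divisibility using (divides-refl)
open import Data.Nat.DivMod using
  (_/_; _%_; m≡m%n+[m/n]*n; m%n<n; m<n⇒m%n≡m; m<n⇒m/n≡0; [m+kn]%n≡m%n; m<n*o⇒m/o<n;
   m*n/n≡m; +-distrib-/-∣ʳ)
import Data.Nat.Properties as ℕₚ
open import Data.Product using (Σ; ∃; ∃₂; _×_; _,_; proj₁; proj₂)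
import Data.Product.Properties as Productₚ
open import Data.Sum using (_⊎_; inj₁; inj₂)
import Data.Sum.Properties as Sumₚ
open import Data.Unit using (⊤; tt)
open import Function using (_∘_; id; mk↣)
open import Function.Bundles using (_⇔_; mk⇔; Equivalence)
open import Induction.WellFounded using (WellFounded; Acc; acc)
open import Level using (0ℓ)
open import Relation.Binary using
  (Rel; Decidable; DecidableEquality; IsTotalPreorder; IsTotalOrder)
open import Relation.Binary.Construct.On using () renaming (wellFounded to on-wellFounded)
open import Relation.Binary.PropositionalEquality using
  (_≡_; _≢_; refl; sym; trans; cong; cong₂; subst; subst₂; isEquivalence)
open import Relation.Nullary using (¬_; Dec; yes; no; contradiction; recompute; ¬?)
open import Relation.Nullary.Decidable using
  (decidable-stable; _×-dec_; _→-dec_; map′; ⌊_⌋; toWitness; fromWitness; T?; via-injection)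

open Equivalence using (to; from)

-- Unary symbols, their roles and their numbering.

data Kind : Set where
  S L H : Kind

-- The index lists of big conjunctions are opaque: a conjunction then stays folded,
-- and its index set can be inferred from its meaning.
opaque

  kinds : List Kind
  kinds = S ∷ L ∷ H ∷ []

  ∈-kinds : ∀ k → k ∈ kinds
  ∈-kinds S = here refl
  ∈-kinds L = there (here refl)
  ∈-kinds H = there (there (here refl))

-- Labels that occur in pinning formulas: origin is the first node of the first row, turn
-- the last node before the copy of w, and finish a node behind this copy.
data Pin : Set where
  origin turn finish : Pin
  letter             : Letter → Pin

letters : List Letter
letters = 𝕩 ∷ 𝕪 ∷ 𝕦 ∷ 𝕝 ∷ 𝟙 ∷ 𝟚 ∷ eq ∷ neg ∷ conj ∷ disj ∷ imp ∷ univ ∷ exis ∷ []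

letterIndex : Letter → ℕ
letterIndex 𝕩    = 0
letterIndex 𝕪    = 1
letterIndex 𝕦    = 2
letterIndex 𝕝    = 3
letterIndex 𝟙    = 4
letterIndex 𝟚    = 5
letterIndex eq   = 6
letterIndex neg  = 7
letterIndex conj = 8
letterIndex disj = 9
letterIndex imp  = 10
letterIndex univ = 11
letterIndex exis = 12

∈-letters : ∀ a → a ∈ letters
∈-letters 𝕩    = here refl
∈-letters 𝕪    = there (here refl)
∈-letters 𝕦    = there (there (here refl))
∈-letters 𝕝    = there (there (there (here refl)))
∈-letters 𝟙    = there (there (there (there (here refl))))
∈-letters 𝟚    = there (there (there (there (there (here refl)))))
∈-letters eq   = there (there (there (there (there (there (here refl))))))
∈-letters neg  = there (there (there (there (there (there (there (here refl)))))))
∈-letters conj = there (there (there (there (there (there (there (there (here refl))))))))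
∈-letters disj = there (there (there (there (there (there (there (there (there (here refl)))))))))
∈-letters imp  =
  there (there (there (there (there (there (there (there (there (there (here refl))))))))))
∈-letters univ =
  there (there (there (there (there (there (there (there (there (there (there (here refl)))))))))))
∈-letters exis =
  there (there (there (there (there (there (there (there (there (there (there (there (here refl))))))))))))

opaque

  pins : List Pin
  pins = origin ∷ turn ∷ finish ∷ map letter letters

  ∈-pins : ∀ π → π ∈ pins
  ∈-pins origin      = here refl
  ∈-pins turn      = there (here refl)
  ∈-pins finish     = there (there (here refl))
  ∈-pins (letter a) = there (there (there (∈-map⁺ letter (∈-letters a))))

data Role : Set where
  node  : Role
  arrow : Kind → Role
  pin   : Pin → Role
  label : ℕ → Role

-- The pinning formula mentions only numbers below 20, so its letter blocks do not
-- depend on the number of labels.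
code : Role → ℕ
code node             = 0
code (arrow S)        = 1
code (arrow L)        = 2
code (arrow H)        = 3
code (pin origin)      = 4
code (pin turn)      = 5
code (pin finish)     = 6
code (pin (letter a)) = 7 + letterIndex a
code (label j)        = 20 + j

role : ℕ → Role
role 0  = node
role 1  = arrow S
role 2  = arrow L
role 3  = arrow H
role 4  = pin origin
role 5  = pin turn
role 6  = pin finish
role 7  = pin (letter 𝕩)
role 8  = pin (letter 𝕪)
role 9  = pin (letter 𝕦)
role 10 = pin (letter 𝕝)
role 11 = pin (letter 𝟙)
role 12 = pin (letter 𝟚)
role 13 = pin (letter eq)
role 14 = pin (letter neg)
role 15 = pin (letter conj)
role 16 = pin (letter disj)
role 17 = pin (letter imp)
role 18 = pin (letter univ)
role 19 = pin (letter exis)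
role n  = label (n ∸ 20)

role-code : ∀ r → role (code r) ≡ r
role-code node               = refl
role-code (arrow S)          = refl
role-code (arrow L)          = refl
role-code (arrow H)          = refl
role-code (pin origin)        = refl
role-code (pin turn)        = refl
role-code (pin finish)       = refl
role-code (pin (letter 𝕩))    = refl
role-code (pin (letter 𝕪))    = refl
role-code (pin (letter 𝕦))    = refl
role-code (pin (letter 𝕝))    = refl
role-code (pin (letter 𝟙))    = refl
role-code (pin (letter 𝟚))    = refl
role-code (pin (letter eq))   = refl
role-code (pin (letter neg))  = refl
role-code (pin (letter conj)) = refl
role-code (pin (letter disj)) = refl
role-code (pin (letter imp))  = refl
role-code (pin (letter univ)) = refl
role-code (pin (letter exis)) = refl
role-code (label j)           = refl

-- Derived connectives and their meaning.

P : Role → Var → Formula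
P r v = unary (code r) v

iff : Formula → Formula → Formula
iff φ ψ = (φ ⇒ ψ) ∧ (ψ ⇒ φ)

same₁ same₂ : Var → Var → Formula
same₁ v w = v ≾₁ w ∧ w ≾₁ v
same₂ v w = v ≾₂ w ∧ w ≾₂ v

⋀ ⋁ : {A : Set} → List A → (A → Formula) → Formula
⋀ []       f = x ≐ x
⋀ (a ∷ as) f = f a ∧ ⋀ as f
⋁ []       f = ~ x ≐ x
⋁ (a ∷ as) f = f a ∨ ⋁ as f

when only : {A : Set} → Dec A → Formula → Formula
when (yes _) φ = φ
when (no _)  φ = x ≐ x
only (yes _) φ = φ
only (no _)  φ = ~ x ≐ x

module _ {𝔄 : FiniteStructure} {ρ : Assignment 𝔄} where

  ⋀⁺ : ∀ {A} (as : List A) {f} → (∀ a → Holds 𝔄 ρ (f a)) → Holds 𝔄 ρ (⋀ as f)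
  ⋀⁺ []       h = refl
  ⋀⁺ (a ∷ as) h = h a , ⋀⁺ as h

  ⋀⁻ : ∀ {A} {as : List A} {f a} → a ∈ as → Holds 𝔄 ρ (⋀ as f) → Holds 𝔄 ρ (f a)
  ⋀⁻ (here refl) (h , _) = h
  ⋀⁻ (there a∈)  (_ , h) = ⋀⁻ a∈ h

  ⋁⁺ : ∀ {A} {as : List A} {f a} → a ∈ as → Holds 𝔄 ρ (f a) → Holds 𝔄 ρ (⋁ as f)
  ⋁⁺ (here refl) h = inj₁ h
  ⋁⁺ (there a∈)  h = inj₂ (⋁⁺ a∈ h)

  ⋁⁻ : ∀ {A} (as : List A) {f} → Holds 𝔄 ρ (⋁ as f) → ∃ λ a → Holds 𝔄 ρ (f a)
  ⋁⁻ []       h        = contradiction refl h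
  ⋁⁻ (a ∷ as) (inj₁ h) = a , h
  ⋁⁻ (a ∷ as) (inj₂ h) = ⋁⁻ as h

  when⁺ : ∀ {A} (A? : Dec A) {φ} → (A → Holds 𝔄 ρ φ) → Holds 𝔄 ρ (when A? φ)
  when⁺ (yes a) h = h a
  when⁺ (no _)  h = refl

  when⁻ : ∀ {A} (A? : Dec A) {φ} → Holds 𝔄 ρ (when A? φ) → A → Holds 𝔄 ρ φ
  when⁻ (yes _) h a = h
  when⁻ (no ¬a) h a = contradiction a ¬a

  only⁺ : ∀ {A} (A? : Dec A) {φ} → A → Holds 𝔄 ρ φ → Holds 𝔄 ρ (only A? φ)
  only⁺ (yes _) a h = h
  only⁺ (no ¬a) a h = contradiction a ¬a

  only⁻ : ∀ {A} (A? : Dec A) {φ} → Holds 𝔄 ρ (only A? φ) → A × Holds 𝔄 ρ φ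
  only⁻ (yes a) h = a , h
  only⁻ (no _)  h = contradiction refl h

-- Label constraints and the sentence that expresses them.

record Spec : Set₁ where
  field
    #labels  : ℕ

  Label : Set
  Label = Fin #labels

  field
    Allowed  : Kind → Label → Label → Set
    Src Tgt  : Kind → Label → Set
    Ord      : Label → Label → Set
    Pinned   : Pin → Label → Set
    allowed? : ∀ k → Decidable (Allowed k)
    src?     : ∀ k a → Dec (Src k a)
    tgt?     : ∀ k a → Dec (Tgt k a)
    ord?     : Decidable Ord
    pinned?  : ∀ π a → Dec (Pinned π a)

  opaque

    labels : List Label
    labels = allFin #labels

    ∈-labels : ∀ a → a ∈ labels
    ∈-labels = ∈-allFin

  infix 30 _⟪_⟫
  _⟪_⟫ : Label → Var → Formula
  a ⟪ v ⟫ = P (label (toℕ a)) v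

  -- An arrow lies in the ≾₁-class of its source and in the ≾₂-class of its target.
  kindBody : Kind → Formula
  kindBody k =
      -- Since an arrow shares its classes with its two ends, agreement of the preorders on the
      -- arrows of one kind makes this kind a monotone bijection from its sources to its targets.
      (P (arrow k) x ⇒ P (arrow k) y ⇒ iff (x ≾₁ y) (x ≾₂ y))
    ∧ (P (arrow k) x ⇒ ⋁ labels λ a → ⋁ labels λ b → only (allowed? k a b)
        (ex y (a ⟪ y ⟫ ∧ same₁ x y) ∧ ex y (b ⟪ y ⟫ ∧ same₂ x y)))
    ∧ (⋀ labels λ a → when (src? k a) (a ⟪ x ⟫ ⇒ ex y (P (arrow k) y ∧ same₁ x y)))
    ∧ (⋀ labels λ a → when (tgt? k a) (a ⟪ x ⟫ ⇒ ex y (P (arrow k) y ∧ same₂ x y)))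

  body : Formula
  body =
      (P node x ⇒ P node y ⇒ iff (x ≾₁ y) (x ≾₂ y))
    ∧ (P node x ⇒ P node y ⇒ same₁ x y ⇒ x ≐ y)
    ∧ (P node x ⇒ ⋁ labels λ a → a ⟪ x ⟫)
    ∧ (⋀ labels λ a → a ⟪ x ⟫ ⇒ P node x)
    ∧ (⋀ labels λ a → ⋀ labels λ b → when (¬? (a Finₚ.≟ b)) (a ⟪ x ⟫ ⇒ ~ b ⟪ x ⟫))
    ∧ ⋀ kinds kindBody
    -- The nodes from the target on are exactly those strictly beyond the source, so the target is
    -- the immediate successor of the source.
    ∧ (P (arrow S) x ⇒ P node y ⇒ iff (x ≾₂ y) (~ y ≾₁ x))
    ∧ (⋀ labels λ a → ⋀ labels λ b → when (¬? (ord? a b)) (a ⟪ x ⟫ ⇒ b ⟪ y ⟫ ⇒ y ≾₁ x))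
    ∧ (⋀ pins λ π → ⋀ labels λ a → when (pinned? π a) (a ⟪ x ⟫ ⇒ P (pin π) x))
    ∧ (⋀ pins λ π → P (pin π) x ⇒ ⋁ labels λ a → only (pinned? π a) (a ⟪ x ⟫))
    ∧ ex x (P (pin origin) x)
    ∧ ex x (P (pin turn) x)

-- Two variables suffice for a walk of any length: `y` is bound to the arrow, and then `x` is bound
-- anew, to the node at the end of this arrow.
step : Role → Formula → Formula
step r φ = ex y (same₁ x y ∧ P (arrow S) y ∧ ex x (same₂ x y ∧ P r x ∧ φ))

follow : List Letter → Formula
follow []      = step (pin finish) (x ≐ x)
follow (a ∷ w) = step (pin (letter a)) (follow w)

∀∀ : Formula → Sentence
∀∀ φ = all x (all y φ) , closed
  where
  closed : ∀ v → ¬ (v FreeIn all x (all y φ))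
  closed x (x≢x , _)     = x≢x refl
  closed y (_ , y≢y , _) = y≢y refl

sentence : Formula → Sentence
sentence φ = ∀∀ ((P (pin turn) x ⇒ follow (encode φ)) ∧ φ)

-- Diagrams, the structures described by the sentence.

module _ (𝕊 : Spec) where
  open Spec 𝕊

  module _ {Node : Set} (lab : Node → Label) (Next : Rel Node 0ℓ) where

    Follows : List Letter → Node → Set
    Follows []      u = ∃ λ v → Next u v × Pinned finish (lab v)
    Follows (a ∷ w) u = ∃ λ v → Next u v × Pinned (letter a) (lab v) × Follows w v

  -- Both directions of the reduction pass through diagrams, where arrows are relations between
  -- nodes and no longer points of a structure. The computation is then treated without formulas.
  record Diagram {Node : Set} (_≤_ : Rel Node 0ℓ) (w : List Letter) : Set₁ where
    field
      lab       : Node → Label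
      Arrow     : Kind → Rel Node 0ℓ
      allowed   : ∀ k {u v} → Arrow k u v → Allowed k (lab u) (lab v)
      source    : ∀ k {u} → Src k (lab u) → ∃ λ v → Arrow k u v
      target    : ∀ k {v} → Tgt k (lab v) → ∃ λ u → Arrow k u v
      mono      : ∀ k {u v u′ v′} → Arrow k u v → Arrow k u′ v′ → u ≤ u′ ⇔ v ≤ v′
      immediate : ∀ {u v} t → Arrow S u v → v ≤ t ⇔ (¬ t ≤ u)
      ordered   : ∀ {u v} → ¬ v ≤ u → Ord (lab u) (lab v)
      hasOrigin : ∃ λ u → Pinned origin (lab u)
      hasTurn   : ∃ λ u → Pinned turn (lab u)
      follows   : ∀ {u} → Pinned turn (lab u) → Follows lab (Arrow S) w u

  -- From a finite model to a diagram.

  module Extraction (𝔄 : FiniteStructure)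
    (tp₁ : IsTotalPreorder _≡_ (FiniteStructure.R₁ 𝔄))
    (tp₂ : IsTotalPreorder _≡_ (FiniteStructure.R₂ 𝔄))
    (sat : 𝔄 ⊨ sentence body) where

    open FiniteStructure 𝔄
    module T₁ = IsTotalPreorder tp₁
    module T₂ = IsTotalPreorder tp₂

    ⟦_⟧ : Role → Universe → Set
    ⟦ r ⟧ p = U (code r) p

    facts : ∀ p q → _
    facts p q = sat (λ _ → Fin.zero) p q

    _~₁_ _~₂_ : Rel Universe 0ℓ
    p ~₁ q = R₁ p q × R₁ q p
    p ~₂ q = R₂ p q × R₂ q p

    -- Irrelevance of `isNode` makes nodes equal as soon as their points are; `holds` recovers the
    -- proof by decidability.
    record Node : Set where
      constructor mk
      field
        point   : Universe
        .isNode : ⟦ node ⟧ point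

    open Node

    holds : ∀ u → ⟦ node ⟧ (point u)
    holds (mk p n) = recompute (U? _ p) n

    node-≡ : ∀ {u v} → point u ≡ point v → u ≡ v
    node-≡ {mk p _} {mk .p _} refl = refl

    _≤_ : Rel Node 0ℓ
    u ≤ v = R₁ (point u) (point v)

    agree : ∀ u v → u ≤ v ⇔ R₂ (point u) (point v)
    agree u v with facts (point u) (point v)
    ... | _ , h , _ = let f , g = h (holds u) (holds v) in mk⇔ f g

    ≤-antisym : ∀ {u v} → u ≤ v → v ≤ u → u ≡ v
    ≤-antisym {u} {v} u≤v v≤u with facts (point u) (point v)
    ... | _ , _ , h , _ = node-≡ (h (holds u) (holds v) (u≤v , v≤u))

    ~₂⇒≡ : ∀ {u v} → point u ~₂ point v → u ≡ v
    ~₂⇒≡ {u} {v} (a , b) = ≤-antisym (from (agree u v) a) (from (agree v u) b)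

    totalOrder : IsTotalOrder _≡_ _≤_
    totalOrder = record
      { isPartialOrder = record
        { isPreorder = record
          { isEquivalence = isEquivalence
          ; reflexive = λ { refl → T₁.refl }
          ; trans = T₁.trans }
        ; antisym = ≤-antisym }
      ; total = λ u v → T₁.total (point u) (point v) }

    -- A finite universe has no infinite strict ascent. Walks along S-arrows recurse on this.
    rightmost : WellFounded (λ v u → ¬ v ≤ u)
    rightmost = on-wellFounded point (spo-noetherian {_⊏_ = λ p q → ¬ R₁ q p} record
      { isEquivalence = isEquivalence
      ; irrefl = λ { refl p≰p → p≰p T₁.refl }
      ; trans = λ {p} {q} q≰p r≰q r≤p → r≰q (T₁.trans r≤p (below q≰p))
      ; <-resp-≈ = (λ { refl → id }) , (λ { refl → id }) })
      where
      below : ∀ {p q} → ¬ R₁ q p → R₁ p q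
      below {p} {q} q≰p with T₁.total p q
      ... | inj₁ p≤q = p≤q
      ... | inj₂ q≤p = contradiction q≤p q≰p

    opaque

      labelled : ∀ u → ∃ λ (a : Label) → ⟦ label (toℕ a) ⟧ (point u)
      labelled u with facts (point u) (point u)
      ... | _ , _ , _ , h , _ = ⋁⁻ labels (h (holds u))

    lab : Node → Label
    lab u = proj₁ (labelled u)

    label⇒node : ∀ {p} a → ⟦ label (toℕ a) ⟧ p → ⟦ node ⟧ p
    label⇒node {p} a ap with facts p p
    ... | _ , _ , _ , _ , h , _ = ⋀⁻ (∈-labels a) h ap

    label-unique : ∀ {p a b} → ⟦ label (toℕ a) ⟧ p → ⟦ label (toℕ b) ⟧ p → a ≡ b
    label-unique {p} {a} {b} ap bp with facts p p
    ... | _ , _ , _ , _ , _ , h , _ = decidable-stable (a Finₚ.≟ b) λ a≢b →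
      when⁻ (¬? (a Finₚ.≟ b)) (⋀⁻ (∈-labels b) (⋀⁻ (∈-labels a) h)) a≢b ap bp

    lab-≡ : ∀ {u a} → ⟦ label (toℕ a) ⟧ (point u) → lab u ≡ a
    lab-≡ {u} = label-unique (proj₂ (labelled u))

    nodeOf : ∀ {p} a → ⟦ label (toℕ a) ⟧ p → Σ Node λ u → point u ≡ p × lab u ≡ a
    nodeOf {p} a ap = mk p (label⇒node a ap) , refl , lab-≡ ap

    kindFacts : ∀ p q k → _
    kindFacts p q k with facts p q
    ... | _ , _ , _ , _ , _ , _ , h , _ = ⋀⁻ {f = kindBody} (∈-kinds k) h

    Arrow : Kind → Rel Node 0ℓ
    Arrow k u v = ∃ λ p → ⟦ arrow k ⟧ p × point u ~₁ p × point v ~₂ p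

    -- The disjunction in `kindBody` supplies labelled points in the two classes of the arrow, and
    -- labelled points are nodes.
    ends : ∀ k {p} → ⟦ arrow k ⟧ p →
           ∃₂ λ u v → point u ~₁ p × point v ~₂ p × Allowed k (lab u) (lab v)
    ends k {p} kp =
      let _ , h , _ = kindFacts p p k
          a , h₁ = ⋁⁻ labels (h kp)
          b , h₂ = ⋁⁻ labels h₁
          ok , (q , aq , p≤q , q≤p) , (r , br , p≤r , r≤p) = only⁻ (allowed? k a b) h₂
          u , u≡q , lab≡a = nodeOf a aq
          v , v≡r , lab≡b = nodeOf b br
      in u , v , subst (_~₁ p) (sym u≡q) (q≤p , p≤q) , subst (_~₂ p) (sym v≡r) (r≤p , p≤r)
       , subst₂ (Allowed k) (sym lab≡a) (sym lab≡b) ok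

    diagram : Diagram _≤_ (encode body)
    diagram = record
      { lab       = lab
      ; Arrow     = Arrow
      ; allowed   = allowed
      ; source    = source
      ; target    = target
      ; mono      = mono
      ; immediate = λ {u} {v} → immediate {u} {v}
      ; ordered   = ordered
      ; hasOrigin = pinned origin
          (let _ , _ , _ , _ , _ , _ , _ , _ , _ , _ , _ , h , _ = facts Fin.zero Fin.zero in h)
      ; hasTurn   = pinned turn
          (let _ , _ , _ , _ , _ , _ , _ , _ , _ , _ , _ , _ , h = facts Fin.zero Fin.zero in h)
      ; follows   = λ {u} s → follows (encode body) u refl (proj₁ (facts (point u) (point u)) (⇒pin turn s))
      }
      where
      allowed : ∀ k {u v} → Arrow k u v → Allowed k (lab u) (lab v)
      allowed k {u} {v} (p , kp , (u≤p , p≤u) , (v≤p , p≤v)) =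
        let u′ , v′ , (u′≤p , p≤u′) , (v′≤p , p≤v′) , ok = ends k kp
            u′≡u = ≤-antisym {u′} {u} (T₁.trans u′≤p p≤u) (T₁.trans u≤p p≤u′)
            v′≡v = ~₂⇒≡ {v′} {v} (T₂.trans v′≤p p≤v , T₂.trans v≤p p≤v′)
        in subst₂ (Allowed k) (cong lab u′≡u) (cong lab v′≡v) ok

      source : ∀ k {u} → Src k (lab u) → ∃ λ v → Arrow k u v
      source k {u} s =
        let _ , _ , h , _ = kindFacts (point u) (point u) k
            p , kp , u~p = when⁻ (src? k (lab u)) (⋀⁻ (∈-labels (lab u)) h) s (proj₂ (labelled u))
            _ , v , _ , v~p , _ = ends k kp
        in v , p , kp , u~p , v~p

      target : ∀ k {v} → Tgt k (lab v) → ∃ λ u → Arrow k u v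
      target k {v} t =
        let _ , _ , _ , h = kindFacts (point v) (point v) k
            p , kp , v~p = when⁻ (tgt? k (lab v)) (⋀⁻ (∈-labels (lab v)) h) t (proj₂ (labelled v))
            u , _ , u~p , _ , _ = ends k kp
        in u , p , kp , u~p , v~p

      mono : ∀ k {u v u′ v′} → Arrow k u v → Arrow k u′ v′ → u ≤ u′ ⇔ v ≤ v′
      mono k {u} {v} {u′} {v′} (p , kp , (u≤p , p≤u) , (v≤p , p≤v)) (q , kq , (u≤q , q≤u) , (v≤q , q≤v))
        with kindFacts p q k
      ... | h , _ with h kp kq
      ... | f , g = mk⇔
        (λ u≤u′ → from (agree v v′)
          (T₂.trans v≤p (T₂.trans (f (T₁.trans p≤u (T₁.trans u≤u′ u≤q))) q≤v)))
        (λ v≤v′ → T₁.trans u≤p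
          (T₁.trans (g (T₂.trans p≤v (T₂.trans (to (agree v v′) v≤v′) v≤q))) q≤u))

      immediate : ∀ {u v} t → Arrow S u v → v ≤ t ⇔ (¬ t ≤ u)
      immediate {u} {v} t (p , kp , (u≤p , p≤u) , (v≤p , p≤v)) with facts p (point t)
      ... | _ , _ , _ , _ , _ , _ , _ , h , _ with h kp (holds t)
      ... | f , g = mk⇔
        (λ v≤t t≤u → f (T₂.trans p≤v (to (agree v t) v≤t)) (T₁.trans t≤u u≤p))
        (λ t≰u → from (agree v t) (T₂.trans v≤p (g λ t≤p → t≰u (T₁.trans t≤p p≤u))))

      ordered : ∀ {u v} → ¬ v ≤ u → Ord (lab u) (lab v)
      ordered {u} {v} v≰u with facts (point u) (point v)
      ... | _ , _ , _ , _ , _ , _ , _ , _ , h , _ =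
        decidable-stable (ord? (lab u) (lab v)) λ ¬ord → v≰u
          (when⁻ (¬? (ord? (lab u) (lab v)))
            (⋀⁻ (∈-labels (lab v)) (⋀⁻ (∈-labels (lab u)) h))
            ¬ord (proj₂ (labelled u)) (proj₂ (labelled v)))

      pin⇒ : ∀ π {p} → ⟦ pin π ⟧ p → Σ Node λ u → point u ≡ p × Pinned π (lab u)
      pin⇒ π {p} πp with facts p p
      ... | _ , _ , _ , _ , _ , _ , _ , _ , _ , _ , h , _
        with ⋁⁻ labels (⋀⁻ (∈-pins π) h πp)
      ... | a , h′ with only⁻ (pinned? π a) h′
      ... | ok , ap = let u , u≡p , lab≡a = nodeOf a ap in
        u , u≡p , subst (Pinned π) (sym lab≡a) ok

      pinned : ∀ π → ∃ (⟦ pin π ⟧) → ∃ λ u → Pinned π (lab u)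
      pinned π (p , πp) with pin⇒ π πp
      ... | u , _ , ok = u , ok

      ⇒pin : ∀ π {u} → Pinned π (lab u) → ⟦ pin π ⟧ (point u)
      ⇒pin π {u} ok =
        let _ , _ , _ , _ , _ , _ , _ , _ , _ , h , _ = facts (point u) (point u) in
        when⁻ (pinned? π (lab u)) (⋀⁻ (∈-labels (lab u)) (⋀⁻ (∈-pins π) h))
          ok (proj₂ (labelled u))

      -- Only the value of `x` matters, because `step` binds `y` before it is read. The induction
      -- therefore survives the changes of the assignment.
      follows : ∀ w u {ρ} → ρ x ≡ point u → Holds 𝔄 ρ (follow w) → Follows lab (Arrow S) w u
      follows [] u refl (p , u~p , Sp , q , (q≤p , p≤q) , πq , _) with pin⇒ finish πq
      ... | v , refl , ok = v , (p , Sp , u~p , q≤p , p≤q) , ok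
      follows (a ∷ w) u refl (p , u~p , Sp , q , (q≤p , p≤q) , πq , h) with pin⇒ (letter a) πq
      ... | v , refl , ok = v , (p , Sp , u~p , q≤p , p≤q) , ok , follows w v refl h

  -- From a diagram to a finite model.

  module Realisation {n : ℕ} (D : Diagram {Fin (suc n)} Fin._≤_ (encode body))
    (arrow? : ∀ k → Decidable (Diagram.Arrow D k)) where

    open Diagram D

    -- All pairs of nodes serve as points, compared by first component in one preorder and by second
    -- component in the other. The nodes are the diagonal; a pair off the diagonal that represents
    -- no arrow carries no unary symbol.
    Point : Set
    Point = Fin (suc n * suc n)

    opaque

      row col : Point → Fin (suc n)
      row = quotient (suc n)
      col = remainder {suc n} (suc n)

      point : Fin (suc n) → Fin (suc n) → Point
      point = combine

      row-point : ∀ u v → row (point u v) ≡ u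
      row-point u v = cong proj₁ (Finₚ.remQuot-combine u v)

      col-point : ∀ u v → col (point u v) ≡ v
      col-point u v = cong proj₂ (Finₚ.remQuot-combine {suc n} u v)

      point-row-col : ∀ p → point (row p) (col p) ≡ p
      point-row-col = Finₚ.combine-remQuot {suc n} (suc n)

    Means : Role → Point → Set
    Means node      p = row p ≡ col p
    Means (arrow k) p = Arrow k (row p) (col p)
    Means (pin π)   p = row p ≡ col p × Pinned π (lab (row p))
    Means (label j) p = row p ≡ col p × toℕ (lab (row p)) ≡ j

    means? : ∀ r p → Dec (Means r p)
    means? node      p = row p Finₚ.≟ col p
    means? (arrow k) p = arrow? k (row p) (col p)
    means? (pin π)   p = (row p Finₚ.≟ col p) ×-dec pinned? π (lab (row p))
    means? (label j) p = (row p Finₚ.≟ col p) ×-dec (toℕ (lab (row p)) ℕₚ.≟ j)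

    𝔄 : FiniteStructure
    𝔄 = record
      -- `suc n * suc n` computes to the successor of this number, so the universe is `Point`.
      { size-1 = n + n * suc n
      ; U      = λ i → Means (role i)
      ; R₁     = λ p q → row p Fin.≤ row q
      ; R₂     = λ p q → col p Fin.≤ col q
      ; U?     = λ i → means? (role i)
      ; R₁?    = λ p q → row p Finₚ.≤? row q
      ; R₂?    = λ p q → col p Finₚ.≤? col q
      }

    _⊩_ : Point → Role → Set
    p ⊩ r = Means (role (code r)) p

    mean : ∀ r {p} → Means r p → p ⊩ r
    mean r {p} = subst (λ r → Means r p) (sym (role-code r))

    unmean : ∀ r {p} → p ⊩ r → Means r p
    unmean r {p} = subst (λ r → Means r p) (role-code r)

    totalPreorder : (f : Point → Fin (suc n)) → IsTotalPreorder _≡_ (λ p q → f p Fin.≤ f q)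
    totalPreorder f = record
      { isPreorder = record
        { isEquivalence = isEquivalence
        ; reflexive     = λ { refl → ℕₚ.≤-refl }
        ; trans         = ℕₚ.≤-trans }
      ; total = λ p q → ℕₚ.≤-total (toℕ (f p)) (toℕ (f q)) }

    ≡⇒≤≥ : ∀ {u v : Fin (suc n)} → u ≡ v → u Fin.≤ v × v Fin.≤ u
    ≡⇒≤≥ refl = ℕₚ.≤-refl , ℕₚ.≤-refl

    diag : Fin (suc n) → Point
    diag u = point u u

    diag-≡ : ∀ {p q} → row p ≡ col p → row q ≡ col q → row p ≡ row q → p ≡ q
    diag-≡ {p} {q} p-node q-node e =
      trans (sym (point-row-col p))
        (trans (cong₂ point e (trans (sym p-node) (trans e q-node)))
          (point-row-col q))

    diag-node : ∀ u → row (diag u) ≡ col (diag u)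
    diag-node u = trans (row-point u u) (sym (col-point u u))

    row-diag : ∀ u → u ≡ row (diag u)
    row-diag u = sym (row-point u u)

    col-diag : ∀ u → u ≡ col (diag u)
    col-diag u = sym (col-point u u)

    labelled : ∀ {u a} → lab u ≡ a → diag u ⊩ label (toℕ a)
    labelled {u} refl = diag-node u , cong (toℕ ∘ lab) (row-point u u)

    lab-≡ : ∀ {p a} → p ⊩ label (toℕ a) → lab (row p) ≡ a
    lab-≡ (_ , e) = Finₚ.toℕ-injective e

    arrowPoint : ∀ {k u v} → Arrow k u v → point u v ⊩ arrow k
    arrowPoint {k} {u} {v} r = mean (arrow k)
      (subst (λ u′ → Arrow k u′ (col (point u v))) (sym (row-point u v))
        (subst (Arrow k u) (sym (col-point u v)) r))

    follow-holds : ∀ w {ρ u} → u ≡ row (ρ x) → Follows lab (Arrow S) w u →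
                   Holds 𝔄 ρ (follow w)
    follow-holds [] {u = u} refl (v , r , ok) =
      point u v , ≡⇒≤≥ (sym (row-point u v)) , arrowPoint r
      , diag v , ≡⇒≤≥ (trans (col-point v v) (sym (col-point u v)))
      , (diag-node v , subst (Pinned finish ∘ lab) (row-diag v) ok) , refl
    follow-holds (a ∷ w) {u = u} refl (v , r , ok , h) =
      point u v , ≡⇒≤≥ (sym (row-point u v)) , arrowPoint r
      , diag v , ≡⇒≤≥ (trans (col-point v v) (sym (col-point u v)))
      , mean (pin (letter a)) (diag-node v , subst (Pinned (letter a) ∘ lab) (row-diag v) ok)
      , follow-holds w (row-diag v) h

    module _ (ρ₀ : Assignment 𝔄) (p q : Point) where

      ρ : Assignment 𝔄
      ρ = _[_↦_] 𝔄 (_[_↦_] 𝔄 ρ₀ x p) y q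

      kindBody-holds : ∀ k → Holds 𝔄 ρ (kindBody k)
      kindBody-holds k = h₁ , h₂ , h₃ , h₄
        where
        h₁ : p ⊩ arrow k → q ⊩ arrow k → _
        h₁ kp kq = let e = mono k (unmean (arrow k) kp) (unmean (arrow k) kq) in to e , from e
        h₂ : p ⊩ arrow k → _
        h₂ kp = let r = unmean (arrow k) kp in
          ⋁⁺ (∈-labels (lab (row p))) (⋁⁺ (∈-labels (lab (col p)))
            (only⁺ (allowed? k (lab (row p)) (lab (col p))) (allowed k r)
              ((diag (row p) , labelled refl , ≡⇒≤≥ (row-diag (row p)))
              , (diag (col p) , labelled refl , ≡⇒≤≥ (col-diag (col p))))))
        h₃ : _
        h₃ = ⋀⁺ labels λ a → when⁺ (src? k a) λ s ap →
          let v , r = source k (subst (Src k) (sym (lab-≡ ap)) s) in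
          point (row p) v , arrowPoint r , ≡⇒≤≥ (sym (row-point (row p) v))
        h₄ : _
        h₄ = ⋀⁺ labels λ a → when⁺ (tgt? k a) λ { t ap@(node-p , _) →
          let u , r = target k (subst (Tgt k) (sym (trans (cong lab (sym node-p)) (lab-≡ ap))) t) in
          point u (col p) , arrowPoint r , ≡⇒≤≥ (sym (col-point u (col p))) }

      body-holds : Holds 𝔄 ρ body
      body-holds =
          (λ p-node q-node → subst₂ Fin._≤_ p-node q-node
                           , subst₂ Fin._≤_ (sym p-node) (sym q-node))
        , (λ { p-node q-node (p≤q , q≤p) → diag-≡ p-node q-node (Finₚ.≤-antisym p≤q q≤p) })
        , (λ { p-node → ⋁⁺ (∈-labels (lab (row p))) (p-node , refl) })
        , ⋀⁺ labels (λ a → proj₁)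
        , ⋀⁺ labels (λ a → ⋀⁺ labels λ b → when⁺ (¬? (a Finₚ.≟ b)) λ a≢b ap bp →
            a≢b (trans (sym (lab-≡ ap)) (lab-≡ bp)))
        , ⋀⁺ kinds kindBody-holds
        , (λ r q-node → let e = immediate (col q) r in
            subst (λ t → col p Fin.≤ col q → ¬ t Fin.≤ row p) (sym q-node) (to e)
            , (λ q≰p → from e (q≰p ∘ subst (Fin._≤ row p) (sym q-node))))
        , ⋀⁺ labels (λ a → ⋀⁺ labels λ b → when⁺ (¬? (ord? a b)) λ ¬ord ap bq →
            decidable-stable (row q Finₚ.≤? row p) λ q≰p → ¬ord
              (subst (λ a → Ord a b) (lab-≡ ap) (subst (Ord _) (lab-≡ bq) (ordered q≰p))))
        , ⋀⁺ pins (λ π → ⋀⁺ labels λ a → when⁺ (pinned? π a) λ { ok ap@(p-node , _) →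
            mean (pin π) (p-node , subst (Pinned π) (sym (lab-≡ ap)) ok) })
        , ⋀⁺ pins (λ π πp → let p-node , ok = unmean (pin π) πp in
            ⋁⁺ (∈-labels (lab (row p))) (only⁺ (pinned? π (lab (row p))) ok (p-node , refl)))
        , (let u , ok = hasOrigin in diag u , diag-node u , subst (Pinned origin ∘ lab) (row-diag u) ok)
        , (let u , ok = hasTurn in diag u , diag-node u , subst (Pinned turn ∘ lab) (row-diag u) ok)

    satisfiable : FinitelySatisfiable (sentence body)
    satisfiable = 𝔄 , totalPreorder row , totalPreorder col , λ ρ p q →
      (λ { (_ , ok) → follow-holds (encode body) refl (follows ok) }) , body-holds ρ p q

-- Configurations as rows of symbols that evolve locally.

module _ (M : TuringMachine) where
  open TuringMachine M

  data Symbol : Set where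
    lend rend : Symbol
    cell      : TapeSymbol → Symbol
    head      : State → TapeSymbol → Symbol

  arriving : Move → Action State TapeSymbol → Maybe State
  arriving right (next q _ right) = just q
  arriving left  (next q _ left)  = just q
  arriving _     _                = nothing

  leaving : Move → Symbol → Maybe State
  leaving m (head q a) = arriving m (δ q a)
  leaving m _          = nothing

  -- The value is `nothing` if the head would move onto an end marker: a row that is too short for
  -- the step has no successor.
  blocked : Maybe State → Symbol → Maybe Symbol
  blocked (just _) c = nothing
  blocked nothing  c = just c

  entered : Maybe State → Maybe State → TapeSymbol → Symbol
  entered (just q) _        a = head q a
  entered nothing  (just q) a = head q a
  entered nothing  nothing  a = cell a

  -- A halting head yields `nothing`, so that a halted row has no successor either.
  written : Action State TapeSymbol → Maybe Symbol
  written (halt _)        = nothing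
  written (next q b stay) = just (head q b)
  written (next _ b _)    = just (cell b)

  evolve : Symbol → Symbol → Symbol → Maybe Symbol
  evolve l lend       r = blocked (leaving left r) lend
  evolve l rend       r = blocked (leaving right l) rend
  evolve l (cell a)   r = just (entered (leaving right l) (leaving left r) a)
  evolve l (head q a) r = written (δ q a)

  first : List Symbol → Symbol
  first []      = rend
  first (c ∷ _) = c

  infixr 5 _∷_

  data Evolves (l : Symbol) : List Symbol → List Symbol → Set where
    []  : Evolves l [] []
    _∷_ : ∀ {c cs c′ cs′} → evolve l c (first cs) ≡ just c′ → Evolves c cs cs′ →
          Evolves l (c ∷ cs) (c′ ∷ cs′)

  evolves-unique : ∀ {l cs ds es} → Evolves l cs ds → Evolves l cs es → ds ≡ es
  evolves-unique []      []        = refl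
  evolves-unique (p ∷ r) (p′ ∷ r′) =
    cong₂ _∷_ (just-injective (trans (sym p) p′)) (evolves-unique r r′)

  rightPart : List TapeSymbol → List Symbol
  rightPart rs = map cell rs ++ [ rend ]

  leftPart : List TapeSymbol → List Symbol → List Symbol
  leftPart ls cs = lend ∷ (map cell ls ʳ++ cs)

  row : State → List TapeSymbol → TapeSymbol → List TapeSymbol → List Symbol
  row q ls a rs = leftPart ls (head q a ∷ rightPart rs)

  last : List TapeSymbol → Symbol
  last []      = lend
  last (a ∷ _) = cell a

  leaving-last : ∀ m ls → leaving m (last ls) ≡ nothing
  leaving-last m []      = refl
  leaving-last m (_ ∷ _) = refl

  leaving-first : ∀ m rs → leaving m (first (rightPart rs)) ≡ nothing
  leaving-first m []      = refl
  leaving-first m (_ ∷ _) = refl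

  rightPart-static : ∀ {l} rs → leaving right l ≡ nothing →
                     Evolves l (rightPart rs) (rightPart rs)
  rightPart-static []       e = cong (λ s → blocked s rend) e ∷ []
  rightPart-static (r ∷ rs) e =
    cong just (cong₂ (λ s s′ → entered s s′ r) e (leaving-first left rs))
    ∷ rightPart-static rs refl

  -- The left half is stored with the nearest cell first. Each recursive call moves one cell into
  -- the continuation, which therefore has to be arbitrary.
  leftPart-static : ∀ {l cs ds} ls → leaving left (first cs) ≡ nothing →
                    Evolves (last ls) cs ds → Evolves l (leftPart ls cs) (leftPart ls ds)
  leftPart-static []       e r = cong (λ s → blocked s lend) e ∷ r
  leftPart-static (a ∷ ls) e r = leftPart-static ls refl
    (cong just (cong₂ (λ s s′ → entered s s′ a) (leaving-last right ls) e) ∷ r)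

  leftPart-inv : ∀ {l cs es} ls → Evolves l (leftPart ls cs) es → ∃ λ ds → Evolves (last ls) cs ds
  leftPart-inv []       (_ ∷ r) = _ , r
  leftPart-inv (a ∷ ls) r with leftPart-inv ls r
  ... | _ , _ ∷ r′ = _ , r′

  arriving-≡ : ∀ {m q a α} → δ q a ≡ α → leaving m (head q a) ≡ arriving m α
  arriving-≡ {m} = cong (arriving m)

  module _ {q q′ : State} {a b : TapeSymbol} {l : Symbol} where

    row-stay : δ q a ≡ next q′ b stay → ∀ ls rs →
               Evolves l (row q ls a rs) (row q′ ls b rs)
    row-stay e ls rs = leftPart-static ls (arriving-≡ e)
      (cong written e ∷ rightPart-static rs (arriving-≡ e))

    row-left : δ q a ≡ next q′ b left → ∀ c ls rs →
               Evolves l (row q (c ∷ ls) a rs) (row q′ ls c (b ∷ rs))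
    row-left e c ls rs = leftPart-static ls refl
      (cong just (cong₂ (λ s s′ → entered s s′ c) (leaving-last right ls) (arriving-≡ e))
      ∷ cong written e ∷ rightPart-static rs (arriving-≡ e))

    row-right : δ q a ≡ next q′ b right → ∀ ls c rs →
                Evolves l (row q ls a (c ∷ rs)) (row q′ (b ∷ ls) c rs)
    row-right e ls c rs = leftPart-static ls (arriving-≡ e)
      (cong written e
      ∷ cong just (cong₂ (λ s s′ → entered s s′ c) (arriving-≡ e) (leaving-first left rs))
      ∷ rightPart-static rs refl)

    stuck-left : δ q a ≡ next q′ b left → ∀ {rs cs} → ¬ Evolves l (row q [] a rs) cs
    stuck-left e (p ∷ _)
      with () ← trans (sym (cong (λ s → blocked s lend) (arriving-≡ {left} e))) p

    stuck-right : δ q a ≡ next q′ b right → ∀ {ls cs} → ¬ Evolves l (row q ls a []) cs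
    stuck-right e {ls} r with leftPart-inv ls r
    ... | _ , _ ∷ p ∷ _
      with () ← trans (sym (cong (λ s → blocked s rend) (arriving-≡ {right} e))) p

  halted-stuck : ∀ {q a b l ls rs cs} → δ q a ≡ halt b → ¬ Evolves l (row q ls a rs) cs
  halted-stuck {ls = ls} e r with leftPart-inv ls r
  ... | _ , p ∷ _ with () ← trans (sym (cong written e)) p

  -- Together with `evolve-rend⁻` this keeps the right end marker in its column, so a row and its
  -- successor end at corresponding nodes.
  evolve-rend : ∀ {l c r} → evolve l c r ≡ just rend → c ≡ rend
  evolve-rend {c = lend}     {r} e with leaving left r
  evolve-rend {c = lend}     {r} () | just _
  evolve-rend {c = lend}     {r} () | nothing
  evolve-rend {c = rend}         e = refl
  evolve-rend {l} {cell a} {r} e with leaving right l | leaving left r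
  evolve-rend {l} {cell a} {r} () | just _  | _
  evolve-rend {l} {cell a} {r} () | nothing | just _
  evolve-rend {l} {cell a} {r} () | nothing | nothing
  evolve-rend {c = head q a} e with δ q a
  evolve-rend {c = head q a} () | halt _
  evolve-rend {c = head q a} () | next _ _ left
  evolve-rend {c = head q a} () | next _ _ stay
  evolve-rend {c = head q a} () | next _ _ right

  evolve-rend⁻ : ∀ {l r c} → evolve l rend r ≡ just c → c ≡ rend
  evolve-rend⁻ {l} e with leaving right l
  evolve-rend⁻ {l} refl | nothing = refl
  evolve-rend⁻ {l} ()   | just _

  -- Blanks are appended to both halves of a tape, as a row is finite.
  padded : ℕ → List TapeSymbol → List TapeSymbol
  padded n as = as ++ replicate n blank

  rowOf : State → ℕ → Tape M → ℕ → List Symbol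
  rowOf q i (tape ls a rs) j = row q (padded i ls) a (padded j rs)

  -- Successor rows are unique, so each case compares `cs` with the row computed from the step.
  -- Where the head leaves the listed part of the tape, one padding blank is used up; without one
  -- the row is stuck.
  rowOf-inv : ∀ {q q′ b m l cs} i t j → δ q (Tape.scanned t) ≡ next q′ b m →
              Evolves l (rowOf q i t j) cs →
              ∃₂ λ i′ j′ → cs ≡ rowOf q′ i′ (move M m (write M b t)) j′
  rowOf-inv {m = left} zero (tape [] a rs) j e r = contradiction r (stuck-left e)
  rowOf-inv {m = left} (suc i) (tape [] a rs) j e r =
    i , j , evolves-unique r (row-left e blank (padded i []) (padded j rs))
  rowOf-inv {m = left} i (tape (c ∷ ls) a rs) j e r =
    i , j , evolves-unique r (row-left e c (padded i ls) (padded j rs))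
  rowOf-inv {m = stay} i (tape ls a rs) j e r =
    i , j , evolves-unique r (row-stay e (padded i ls) (padded j rs))
  rowOf-inv {m = right} i (tape ls a []) zero e r =
    contradiction r (stuck-right e {padded i ls})
  rowOf-inv {m = right} i (tape ls a []) (suc j) e r =
    i , j , evolves-unique r (row-right e (padded i ls) blank (padded j []))
  rowOf-inv {m = right} i (tape ls a (c ∷ rs)) j e r =
    i , j , evolves-unique r (row-right e (padded i ls) c (padded j rs))

  -- A step uses at most one blank of either padding, so padding beyond `n` before the step leaves
  -- at least `n` after it.
  rowOf-step : ∀ {q q′ b m l} i t j n → δ q (Tape.scanned t) ≡ next q′ b m →
               n ℕ.< i → n ℕ.< j →
               ∃₂ λ i′ j′ → n ℕ.≤ i′ × n ℕ.≤ j′ ×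
               Evolves l (rowOf q i t j) (rowOf q′ i′ (move M m (write M b t)) j′)
  rowOf-step {m = left} (suc i) (tape [] a rs) j n e n<i n<j =
    i , j , ℕ.s≤s⁻¹ n<i , ℕₚ.<⇒≤ n<j , row-left e blank (padded i []) (padded j rs)
  rowOf-step {m = left} i (tape (c ∷ ls) a rs) j n e n<i n<j =
    i , j , ℕₚ.<⇒≤ n<i , ℕₚ.<⇒≤ n<j , row-left e c (padded i ls) (padded j rs)
  rowOf-step {m = stay} i (tape ls a rs) j n e n<i n<j =
    i , j , ℕₚ.<⇒≤ n<i , ℕₚ.<⇒≤ n<j , row-stay e (padded i ls) (padded j rs)
  rowOf-step {m = right} i (tape ls a []) (suc j) n e n<i n<j =
    i , j , ℕₚ.<⇒≤ n<i , ℕ.s≤s⁻¹ n<j , row-right e (padded i ls) blank (padded j [])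
  rowOf-step {m = right} i (tape ls a (c ∷ rs)) j n e n<i n<j =
    i , j , ℕₚ.<⇒≤ n<i , ℕₚ.<⇒≤ n<j , row-right e (padded i ls) c (padded j rs)

-- The word of the sentence, its blocks and its phases.

letter-≟ : DecidableEquality Letter
letter-≟ = via-injection (mk↣ letterIndex-injective) ℕₚ._≟_
  where
  letterAt : ℕ → Letter
  letterAt 0  = 𝕩
  letterAt 1  = 𝕪
  letterAt 2  = 𝕦
  letterAt 3  = 𝕝
  letterAt 4  = 𝟙
  letterAt 5  = 𝟚
  letterAt 6  = eq
  letterAt 7  = neg
  letterAt 8  = conj
  letterAt 9  = disj
  letterAt 10 = imp
  letterAt 11 = univ
  letterAt _  = exis

  letterAt-index : ∀ a → letterAt (letterIndex a) ≡ a
  letterAt-index 𝕩    = refl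
  letterAt-index 𝕪    = refl
  letterAt-index 𝕦    = refl
  letterAt-index 𝕝    = refl
  letterAt-index 𝟙    = refl
  letterAt-index 𝟚    = refl
  letterAt-index eq   = refl
  letterAt-index neg  = refl
  letterAt-index conj = refl
  letterAt-index disj = refl
  letterAt-index imp  = refl
  letterAt-index univ = refl
  letterAt-index exis = refl

  letterIndex-injective : ∀ {a b} → letterIndex a ≡ letterIndex b → a ≡ b
  letterIndex-injective {a} {b} e =
    trans (sym (letterAt-index a)) (trans (cong letterAt e) (letterAt-index b))

-- For w = encode φ, the encoding of ∀∀ ((turn x ⇒ follow w) ∧ φ) is the letter univ
-- followed by the words of prefix, gadget a for the letters a of w, pivot, and copy a
-- for the letters a of w.
data Block : Set where
  prefix pivot : Block
  gadget copy  : Letter → Block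

block-≟ : DecidableEquality Block
block-≟ = via-injection (mk↣ injective) (Sumₚ.≡-dec letter-≟ (Sumₚ.≡-dec letter-≟ Boolₚ._≟_))
  where
  embed : Block → Letter ⊎ (Letter ⊎ Bool)
  embed (gadget a) = inj₁ a
  embed (copy a)   = inj₂ (inj₁ a)
  embed prefix     = inj₂ (inj₂ true)
  embed pivot      = inj₂ (inj₂ false)

  injective : ∀ {b c} → embed b ≡ embed c → b ≡ c
  injective {gadget _} {gadget _} refl = refl
  injective {copy _}   {copy _}   refl = refl
  injective {prefix}   {prefix}   refl = refl
  injective {pivot}    {pivot}    refl = refl

-- Prefix notation puts the continuation of `step r` last. This is the part of its word between the
-- initial `exis` and the word of that continuation.
stepLetters : Role → List Letter
stepLetters r =
  𝕪 ∷ conj ∷ encode (same₁ x y) ++ conj ∷ encode (P (arrow S) y) ++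
  exis ∷ 𝕩 ∷ conj ∷ encode (same₂ x y) ++ conj ∷ encode (P r x)

word : Block → Letter × List Letter
word prefix     = 𝕩 , univ ∷ 𝕪 ∷ conj ∷ imp ∷ encode (P (pin turn) x)
word (gadget a) = exis , stepLetters (pin (letter a))
word pivot      = exis , stepLetters (pin finish) ++ encode (x ≐ x)
word (copy a)   = a , []

letters⟨_⟩ : Block → List Letter
letters⟨ b ⟩ = proj₁ (word b) ∷ proj₂ (word b)

precedes : Block → Block → Bool
precedes prefix     (gadget _) = true
precedes prefix     pivot      = true
precedes (gadget _) (gadget _) = true
precedes (gadget _) pivot      = true
precedes pivot      (copy _)   = true
precedes (copy _)   (copy _)   = true
precedes _          _          = false

-- In text b a as, the word of b ends in a ∷ as, and the node stands for a. The node edge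
-- stands for the first letter of the input, scanned by the head.
data Phase : Set where
  opening padL edge padR closing : Phase
  text : Block → Letter → List Letter → Phase

firstOf : Block → Phase
firstOf b = text b (proj₁ (word b)) (proj₂ (word b))

-- The pivot is included because labels alone do not exclude an empty copy.
ends : Block → Bool
ends pivot    = true
ends (copy _) = true
ends _        = false

letters-≟ : DecidableEquality (List Letter)
letters-≟ = Listₚ.≡-dec letter-≟

-- Within a block the remaining letters of a phase dictate the next phase; a new block has to start
-- with its whole word. Only the choice of the next block and the amount of padding are free.
mayFollow : Phase → Phase → Bool
mayFollow opening padL = true
mayFollow opening edge = true
mayFollow padL    padL = true
mayFollow padL    edge = true
mayFollow edge    (text prefix a as) = ⌊ letters-≟ (a ∷ as) letters⟨ prefix ⟩ ⌋
mayFollow (text b _ [])       (text c a as) =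
  precedes b c & ⌊ letters-≟ (a ∷ as) letters⟨ c ⟩ ⌋
mayFollow (text b _ (a ∷ as)) (text c d ds) =
  ⌊ block-≟ b c ⌋ & ⌊ letters-≟ (a ∷ as) (d ∷ ds) ⌋
mayFollow (text b _ []) padR    = ends b
mayFollow (text b _ []) closing = ends b
mayFollow padR          padR    = true
mayFollow padR          closing = true
mayFollow _             _       = false

-- Ranks increase weakly along the first row. Since `body` demands this of any two nodes with
-- phases, ranks compare nodes that are not yet known to be joined by S-arrows.
rank : Phase → ℕ
rank opening               = 0
rank padL                  = 0
rank edge                  = 0
rank (text prefix _ _)     = 0
rank (text (gadget _) _ _) = 1
rank (text pivot _ _)      = 2
rank (text (copy _) _ _)   = 3
rank padR                  = 4
rank closing               = 4

≡just⇒Is-just : ∀ {A : Set} {m : Maybe A} {a} → m ≡ just a → Is-just m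
≡just⇒Is-just refl = just tt

Is-just⇒≡just : ∀ {A : Set} {m : Maybe A} → Is-just m → ∃ λ a → m ≡ just a
Is-just⇒≡just {m = just a} _ = a , refl

-- These select the ends of H-arrows. A gadget is represented by its last letter only, so it occurs
-- once in the matching.
gadgetLetter copyLetter : Maybe Phase → Maybe Letter
gadgetLetter (just (text (gadget a) _ [])) = just a
gadgetLetter _                             = nothing
copyLetter (just (text (copy _) a _)) = just a
copyLetter _                          = nothing

blocks : List Block
blocks = prefix ∷ pivot ∷ map gadget letters ++ map copy letters

∈-blocks : ∀ b → b ∈ blocks
∈-blocks prefix     = here refl
∈-blocks pivot      = there (here refl)
∈-blocks (gadget a) = there (there (∈-++⁺ˡ (∈-map⁺ gadget (∈-letters a))))
∈-blocks (copy a)   = there (there (∈-++⁺ʳ (map gadget letters) (∈-map⁺ copy (∈-letters a))))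

textFrom : Block → Letter → List Letter → List Phase
textFrom b a []        = [ text b a [] ]
textFrom b a (a′ ∷ as) = text b a (a′ ∷ as) ∷ textFrom b a′ as

textOf : Block → List Phase
textOf b = textFrom b (proj₁ (word b)) (proj₂ (word b))

phases : List Phase
phases = opening ∷ padL ∷ edge ∷ padR ∷ closing ∷ concatMap textOf blocks

textOf⊆phases : ∀ b {p} → p ∈ textOf b → p ∈ phases
textOf⊆phases b p∈ =
  there (there (there (there (there (∈-concatMap⁺ textOf (Any.map (λ { refl → p∈ }) (∈-blocks b)))))))

-- Tags and the constraints on them.

module _ (M : TuringMachine) where
  open TuringMachine M

  tapeSymbol-≟ : DecidableEquality TapeSymbol
  tapeSymbol-≟ = Sumₚ.≡-dec letter-≟ Finₚ._≟_

  symbol-≟ : DecidableEquality (Symbol M)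
  symbol-≟ = via-injection (mk↣ injective)
    (Sumₚ.≡-dec tapeSymbol-≟ (Sumₚ.≡-dec (Productₚ.≡-dec Finₚ._≟_ tapeSymbol-≟) Boolₚ._≟_))
    where
    embed : Symbol M → TapeSymbol ⊎ (State × TapeSymbol) ⊎ Bool
    embed (cell a)   = inj₁ a
    embed (head q a) = inj₂ (inj₁ (q , a))
    embed lend       = inj₂ (inj₂ true)
    embed rend       = inj₂ (inj₂ false)

    injective : ∀ {c d} → embed c ≡ embed d → c ≡ d
    injective {cell _}   {cell _}   refl = refl
    injective {head _ _} {head _ _} refl = refl
    injective {lend}     {lend}     refl = refl
    injective {rend}     {rend}     refl = refl

  action-≟ : ∀ (α : Action State TapeSymbol) b → Dec (α ≡ halt b)
  action-≟ (halt a)     b = map′ (cong halt) (λ { refl → refl }) (a Boolₚ.≟ b)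
  action-≟ (next _ _ _) b = no λ ()

  tapeSymbols : List TapeSymbol
  tapeSymbols = map inj₁ letters ++ map inj₂ (allFin (suc #auxiliary))

  ∈-tapeSymbols : ∀ a → a ∈ tapeSymbols
  ∈-tapeSymbols (inj₁ a) = ∈-++⁺ˡ (∈-map⁺ inj₁ (∈-letters a))
  ∈-tapeSymbols (inj₂ i) = ∈-++⁺ʳ (map inj₁ letters) (∈-map⁺ inj₂ (∈-allFin i))

  symbols : List (Symbol M)
  symbols =
    lend ∷ rend ∷ map cell tapeSymbols ++ cartesianProductWith head (allFin #states) tapeSymbols

  ∈-symbols : ∀ c → c ∈ symbols
  ∈-symbols lend       = here refl
  ∈-symbols rend       = there (here refl)
  ∈-symbols (cell a)   = there (there (∈-++⁺ˡ (∈-map⁺ cell (∈-tapeSymbols a))))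
  ∈-symbols (head q a) = there (there (∈-++⁺ʳ (map cell tapeSymbols)
    (∈-cartesianProductWith⁺ head (∈-allFin q) (∈-tapeSymbols a))))

  symbolOf : Phase → Symbol M
  symbolOf opening      = lend
  symbolOf padL         = cell blank
  symbolOf edge         = head start (inj₁ univ)
  symbolOf (text _ a _) = cell (inj₁ a)
  symbolOf padR         = cell blank
  symbolOf closing      = rend

  -- A node stands for a symbol of a row, together with the two neighbouring symbols,
  -- its phase if the row is the first one, and whether the row is the last one.
  record Tag : Set where
    constructor mkTag
    field
      left′ centre right′ : Symbol M
      phase               : Maybe Phase
      final               : Bool

  open Tag

  -- Opaque, since the normal form of this list is astronomical.
  opaque

    tags : List Tag
    tags = cartesianProductWith (λ f b → f b)
      (cartesianProductWith (λ f p → f p)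
        (cartesianProductWith (λ f r → f r) (cartesianProductWith mkTag symbols symbols) symbols)
        (nothing ∷ map just phases))
      (false ∷ true ∷ [])

    ∈-tags : ∀ t → (∀ {p} → phase t ≡ just p → p ∈ phases) → t ∈ tags
    ∈-tags (mkTag l c r p b) ok =
      ∈-cartesianProductWith⁺ (λ f b → f b)
        (∈-cartesianProductWith⁺ (λ f p → f p)
          (∈-cartesianProductWith⁺ (λ f r → f r)
            (∈-cartesianProductWith⁺ mkTag (∈-symbols l) (∈-symbols c)) (∈-symbols r))
          (∈-phase p ok))
        (∈-bool b)
      where
      ∈-phase : ∀ p → (∀ {q} → p ≡ just q → q ∈ phases) → p ∈ nothing ∷ map just phases
      ∈-phase nothing  ok = here refl
      ∈-phase (just p) ok = there (∈-map⁺ just (ok refl))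
      ∈-bool : ∀ b → b ∈ false ∷ true ∷ []
      ∈-bool false = here refl
      ∈-bool true  = there (here refl)

  -- Imposed on final rows: a computation may stop there only with the answer `false`.
  Halted : Symbol M → Set
  Halted (head q a) = δ q a ≡ halt false
  Halted _          = ⊤

  halted? : ∀ c → Dec (Halted c)
  halted? (head q a) = action-≟ (δ q a) false
  halted? (cell _)   = yes tt
  halted? lend       = yes tt
  halted? rend       = yes tt

  PhaseCentre : Maybe Phase → Symbol M → Set
  PhaseCentre nothing  c = ⊤
  PhaseCentre (just p) c = c ≡ symbolOf p

  phaseCentre? : ∀ p c → Dec (PhaseCentre p c)
  phaseCentre? nothing  c = yes tt
  phaseCentre? (just p) c = symbol-≟ c (symbolOf p)

  PhaseStep : Maybe Phase → Maybe Phase → Set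
  PhaseStep nothing  nothing   = ⊤
  PhaseStep (just p) (just p′) = T (mayFollow p p′)
  PhaseStep _        _         = ⊥

  phaseStep? : ∀ p p′ → Dec (PhaseStep p p′)
  phaseStep? nothing  nothing   = yes tt
  phaseStep? (just p) (just p′) = T? (mayFollow p p′)
  phaseStep? nothing  (just _)  = no id
  phaseStep? (just _) nothing   = no id

  PhaseOrd : Maybe Phase → Maybe Phase → Set
  PhaseOrd (just p) (just p′) = rank p ℕ.≤ rank p′
  PhaseOrd _        _         = ⊤

  phaseOrd? : ∀ p p′ → Dec (PhaseOrd p p′)
  phaseOrd? (just p) (just p′) = rank p ℕₚ.≤? rank p′
  phaseOrd? (just _) nothing   = yes tt
  phaseOrd? nothing  _         = yes tt

  PhasePin : Pin → Maybe Phase → Set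
  PhasePin origin      p = p ≡ just opening
  PhasePin turn      (just (text pivot _ [])) = ⊤
  PhasePin turn      _                        = ⊥
  PhasePin finish     (just p)                 = rank p ≡ 4
  PhasePin finish     nothing                  = ⊥
  PhasePin (letter a) p                        = copyLetter p ≡ just a

  isOpening? : ∀ (p : Maybe Phase) → Dec (p ≡ just opening)
  isOpening? (just opening)      = yes refl
  isOpening? (just padL)         = no λ ()
  isOpening? (just edge)         = no λ ()
  isOpening? (just padR)         = no λ ()
  isOpening? (just closing)      = no λ ()
  isOpening? (just (text _ _ _)) = no λ ()
  isOpening? nothing             = no λ ()

  isStart? : ∀ p → Dec (PhasePin turn p)
  isStart? (just (text pivot _ []))        = yes tt
  isStart? (just (text pivot _ (_ ∷ _)))   = no id
  isStart? (just (text prefix _ _))        = no id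
  isStart? (just (text (gadget _) _ _))    = no id
  isStart? (just (text (copy _) _ _))      = no id
  isStart? (just opening)                  = no id
  isStart? (just padL)                     = no id
  isStart? (just edge)                     = no id
  isStart? (just padR)                     = no id
  isStart? (just closing)                  = no id
  isStart? nothing                         = no id

  phasePin? : ∀ π p → Dec (PhasePin π p)
  phasePin? origin      p        = isOpening? p
  phasePin? turn      p        = isStart? p
  phasePin? finish     (just p) = rank p ℕₚ.≟ 4
  phasePin? finish     nothing  = no id
  phasePin? (letter a) p        = Maybeₚ.≡-dec letter-≟ (copyLetter p) (just a)

  Sound : Tag → Set
  Sound t = PhaseCentre (phase t) (centre t) × (final t ≡ true → Halted (centre t))

  sound? : ∀ t → Dec (Sound t)
  sound? t = phaseCentre? (phase t) (centre t) ×-dec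
             ((final t Boolₚ.≟ true) →-dec halted? (centre t))

  -- S-arrows transport `final` along a row and impose `Sound` on their targets, hence on all nodes
  -- of a row except possibly its first. L-arrows lead to nodes without a phase, which sets the
  -- first row apart.
  TagAllowed : Kind → Tag → Tag → Set
  TagAllowed S t u = centre t ≢ rend × right′ t ≡ centre u × centre t ≡ left′ u × final t ≡ final u
                   × PhaseStep (phase t) (phase u) × Sound u
  TagAllowed L t u = final t ≡ false × phase u ≡ nothing
                   × evolve M (left′ t) (centre t) (right′ t) ≡ just (centre u)
  TagAllowed H t u = Is-just (gadgetLetter (phase t))
                   × gadgetLetter (phase t) ≡ copyLetter (phase u)

  nothing? : ∀ {A : Set} (p : Maybe A) → Dec (p ≡ nothing)
  nothing? nothing  = yes refl
  nothing? (just _) = no λ ()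

  tagAllowed? : ∀ k → Decidable (TagAllowed k)
  tagAllowed? S t u = ¬? (symbol-≟ (centre t) rend) ×-dec symbol-≟ (right′ t) (centre u)
    ×-dec symbol-≟ (centre t) (left′ u)
    ×-dec (final t Boolₚ.≟ final u) ×-dec phaseStep? (phase t) (phase u) ×-dec sound? u
  tagAllowed? L t u = (final t Boolₚ.≟ false) ×-dec nothing? (phase u)
    ×-dec Maybeₚ.≡-dec symbol-≟ (evolve M (left′ t) (centre t) (right′ t)) (just (centre u))
  tagAllowed? H t u = dec (λ _ → yes tt) (gadgetLetter (phase t))
    ×-dec Maybeₚ.≡-dec letter-≟ (gadgetLetter (phase t)) (copyLetter (phase u))

  TagSrc TagTgt : Kind → Tag → Set
  TagSrc S t = centre t ≢ rend
  TagSrc L t = final t ≡ false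
  TagSrc H t = Is-just (gadgetLetter (phase t))
  -- The first node of a row has no S-predecessor.
  TagTgt S t = ⊥
  TagTgt L t = phase t ≡ nothing
  TagTgt H t = Is-just (copyLetter (phase t))

  tagSrc? : ∀ k t → Dec (TagSrc k t)
  tagSrc? S t = ¬? (symbol-≟ (centre t) rend)
  tagSrc? L t = final t Boolₚ.≟ false
  tagSrc? H t = dec (λ _ → yes tt) (gadgetLetter (phase t))

  tagTgt? : ∀ k t → Dec (TagTgt k t)
  tagTgt? S t = no id
  tagTgt? L t = nothing? (phase t)
  tagTgt? H t = dec (λ _ → yes tt) (copyLetter (phase t))

  tagAt : Fin (length tags) → Tag
  tagAt = lookup tags

  spec : Spec
  spec = record
    { #labels  = length tags
    ; Allowed  = λ k a b → TagAllowed k (tagAt a) (tagAt b)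
    ; Src      = λ k a → TagSrc k (tagAt a)
    ; Tgt      = λ k a → TagTgt k (tagAt a)
    ; Ord      = λ a b → PhaseOrd (phase (tagAt a)) (phase (tagAt b))
    -- The origin is not reached by an S-arrow, so its symbol is fixed here rather than by `Sound`.
    ; Pinned   = λ π a → PhasePin π (phase (tagAt a)) × PhaseCentre (phase (tagAt a)) (centre (tagAt a))
    ; allowed? = λ k a b → tagAllowed? k (tagAt a) (tagAt b)
    ; src?     = λ k a → tagSrc? k (tagAt a)
    ; tgt?     = λ k a → tagTgt? k (tagAt a)
    ; ord?     = λ a b → phaseOrd? (phase (tagAt a)) (phase (tagAt b))
    ; pinned?  = λ π a → phasePin? π (phase (tagAt a)) ×-dec phaseCentre? (phase (tagAt a)) (centre (tagAt a))
    }

  φ : Sentence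
  φ = sentence (Spec.body spec)

-- A model of the sentence excludes an accepting run.

module _ (M : TuringMachine) where
  open TuringMachine M
  open Tag

  letterCells : List Letter → List (Symbol M)
  letterCells = map (cell ∘ inj₁)

  blanks : ℕ → List (Symbol M)
  blanks n = replicate n (cell blank)

  blanks-ʳ++ : ∀ n cs → blanks n ʳ++ cs ≡ blanks n ++ cs
  blanks-ʳ++ zero    cs = refl
  blanks-ʳ++ (suc n) cs = trans (blanks-ʳ++ n _) (shift n)
    where
    shift : ∀ n → blanks n ++ cell blank ∷ cs ≡ cell blank ∷ blanks n ++ cs
    shift zero    = refl
    shift (suc n) = cong (cell blank ∷_) (shift n)

  rowOf-initial : ∀ i a as j → rowOf M start i (initial M (a ∷ as)) j ≡
    lend ∷ blanks i ++ head start (inj₁ a) ∷ letterCells as ++ blanks j ++ [ rend ]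
  rowOf-initial i a as j = cong (lend ∷_)
    (trans (cong (_ʳ++ _) (Listₚ.map-replicate cell i blank))
      (trans (blanks-ʳ++ i _) (cong (λ cs → blanks i ++ head start (inj₁ a) ∷ cs) right-half)))
    where
    right-half : rightPart M (padded M j (map inj₁ as)) ≡ letterCells as ++ blanks j ++ [ rend ]
    right-half = trans (cong (_++ [ rend ])
        (trans (Listₚ.map-++ cell (map inj₁ as) (replicate j blank))
          (cong₂ _++_ (sym (Listₚ.map-∘ as)) (Listₚ.map-replicate cell j blank))))
      (Listₚ.++-assoc (letterCells as) (blanks j) [ rend ])

  module Soundness {Node : Set} {_≤_ : Rel Node 0ℓ} (total : IsTotalOrder _≡_ _≤_)
    (rightmost : WellFounded (λ v u → ¬ v ≤ u)) {w : List Letter}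
    (D : Diagram (spec M) _≤_ w) where

    open Diagram D
    module O = IsTotalOrder total

    tag : Node → Tag M
    tag u = tagAt M (lab u)

    ph : Node → Maybe Phase
    ph u = phase (tag u)

    mid : Node → Symbol M
    mid u = centre (tag u)

    ≰⇒≤ : ∀ {u v} → ¬ u ≤ v → v ≤ u
    ≰⇒≤ {u} {v} u≰v with O.total u v
    ... | inj₁ u≤v = contradiction u≤v u≰v
    ... | inj₂ v≤u = v≤u

    rank-≤ : ∀ {u v p p′} → u ≤ v → ph u ≡ just p → ph v ≡ just p′ → rank p ℕ.≤ rank p′
    rank-≤ {u} {v} {p} {p′} u≤v e e′ with rank p ℕₚ.≤? rank p′
    ... | yes h = h
    ... | no  h = contradiction (subst₂ (PhaseOrd M) e e′ (ordered v≰u)) h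
      where
      v≰u : ¬ v ≤ u
      v≰u v≤u with O.antisym u≤v v≤u
      ... | refl = h (ℕₚ.≤-reflexive (cong rank (just-injective (trans (sym e) e′))))

    after : ∀ {u v} → Arrow S u v → ¬ v ≤ u
    after {v = v} r = to (immediate v r) O.refl

    -- Here `w` is the immediate successor of `u′`. As `v` lies beyond `u`, its image `v′` lies
    -- beyond `u′`, so `w` is at most `v′`. Conversely `w` lies beyond `u′`, so its preimage `e`
    -- lies beyond `u`; then `v` is at most `e`, and `v′` is at most `w`.
    squeeze : ∀ {k u u′ v v′ w e} → Arrow k u u′ → Arrow k v v′ → Arrow S u′ w → Arrow k e w →
              ¬ v ≤ u → (¬ e ≤ u → v ≤ e) → v′ ≡ w
    squeeze {k} {w = w} uu′ vv′ u′w ew v≰u h = O.antisym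
      (to (mono k vv′ ew) (h (after u′w ∘ to (mono k ew uu′))))
      (from (immediate _ u′w) (v≰u ∘ from (mono k vv′ uu′)))

    data Chain : Node → List (Symbol M) → Set where
      stop : ∀ {u} → mid u ≡ rend → Chain u [ rend ]
      _∷_  : ∀ {u v cs} → Arrow S u v → Chain v cs → Chain u (mid u ∷ cs)

    chain-first : ∀ {u cs} → Chain u cs → first M cs ≡ mid u
    chain-first (stop e) = sym e
    chain-first (_ ∷ _)  = refl

    -- L-arrows send successive nodes to successive nodes, and the right end marker to the right end
    -- marker. Hence the local rule relates two complete rows.
    lift : ∀ {u u′ cs} → Chain u cs → final (tag u) ≡ false → Arrow L u u′ →
           ∃ λ cs′ → Chain u′ cs′ × Evolves M (left′ (tag u)) cs cs′
    lift {u} {u′} (stop e) f r =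
      let _ , _ , ev = allowed L r
          ev′ = subst (λ c → evolve M (left′ (tag u)) c (right′ (tag u)) ≡ just (mid u′)) e ev
          e′ = evolve-rend⁻ M {left′ (tag u)} {right′ (tag u)} ev′
      in _ , stop e′ , subst (λ c → evolve M (left′ (tag u)) rend (right′ (tag u)) ≡ just c) e′ ev′ ∷ []
    lift {u} {u′} (_∷_ {v = v} {cs} s c) f r =
      let _ , ph≡ , ev = allowed L r
          u≢rend , right≡ , left≡ , fin≡ , _ = allowed S s
          v-nonfinal = trans (sym fin≡) f
          v′ , r′ = source L {v} v-nonfinal
          -- Since `u` is not the end marker, neither is `u′`, which thus has a successor `t`.
          t , s′ = source S {u′} (λ e → u≢rend (evolve-rend M (trans ev (cong just e))))
          _ , _ , _ , _ , step-t , _ = allowed S s′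
          -- Like `u′`, its successor `t` has no phase and is therefore the target of an L-arrow.
          e , r″ = target L {t} (phaseless (subst (λ p → PhaseStep M p (ph t)) ph≡ step-t))
          v′≡t = squeeze r r′ s′ r″ (after s) (from (immediate e s))
          cs′ , c′ , evs = lift c v-nonfinal r′
      in mid u′ ∷ cs′ , subst (Arrow S u′) (sym v′≡t) s′ ∷ c′
       , subst (λ x → evolve M (left′ (tag u)) (mid u) x ≡ just (mid u′))
           (trans right≡ (sym (chain-first c))) ev
         ∷ subst (λ l → Evolves M l cs cs′) (sym left≡) evs
      where
      phaseless : ∀ {p} → PhaseStep M nothing p → p ≡ nothing
      phaseless {nothing} _ = refl

    -- Soundness comes from the S-arrow into the node with the head, so this node must not be the
    -- first of the chain.
    halted-final : ∀ {u cs q a} → Chain u cs → final (tag u) ≡ true → mid u ≢ head q a →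
                   head q a ∈ cs → δ q a ≡ halt false
    halted-final (stop e) f ne (here h) = contradiction h λ ()
    halted-final (s ∷ c) f ne (here h) = contradiction (sym h) ne
    halted-final {q = q} {a} (_∷_ {v = v} s c) f ne (there h∈) with symbol-≟ M (mid v) (head q a)
    ... | yes e = let _ , _ , _ , fin≡ , _ , _ , halted = allowed S s in
          subst (Halted M) e (halted (trans (sym fin≡) f))
    ... | no ne′ = let _ , _ , _ , fin≡ , _ = allowed S s in
          halted-final c (trans (sym fin≡) f) ne′ h∈

    head∈row : ∀ {q a} ls rs → head q a ∈ row M q ls a rs
    head∈row {q} {a} ls rs = there (onto ls (here refl))
      where
      onto : ∀ ls {cs} → head q a ∈ cs → head q a ∈ map cell ls ʳ++ cs
      onto []       h = h
      onto (_ ∷ ls) h = onto ls (there h)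

    lend≢head : ∀ {u cs} → Chain u (lend ∷ cs) → ∀ {q a} → mid u ≢ head q a
    lend≢head c e with trans (chain-first c) e
    ... | ()

    -- Induction on the run. In a final row the head would have to answer `false`. Any other row has
    -- a successor row, which is impossible after halting and otherwise represents the next
    -- configuration.
    no-run : ∀ {q t} → Run M q t true → ∀ {u} i j → Chain u (rowOf M q i t j) → ⊥
    no-run {q} {t} run {u} i j c with final (tag u) in f
    no-run {q} {tape ls a rs} (halts e) i j c | true
      with () ← trans (sym e) (halted-final c f (lend≢head c) (head∈row (padded M i ls) (padded M j rs)))
    no-run {q} {tape ls a rs} (steps e _) i j c | true
      with () ← trans (sym e) (halted-final c f (lend≢head c) (head∈row (padded M i ls) (padded M j rs)))
    no-run {q} {tape ls a rs} (halts e) i j c | false =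
      let _ , r = source L f
          _ , _ , evs = lift c f r
      in halted-stuck M {ls = padded M i ls} e evs
    no-run {q} {t} (steps e run) i j c | false =
      let _ , r = source L f
          _ , c′ , evs = lift c f r
          i′ , j′ , cs≡ = rowOf-inv M i t j e evs
      in no-run run i′ j′ (subst (Chain _) cs≡ c′)

    -- With `mid u` left unresolved, walks through consecutive pieces of the first row compose as
    -- functions of what follows their last node.
    After : Node → List (Symbol M) → Set
    After u cs = Chain u (mid u ∷ cs)

    centred : ∀ {u v p} → Arrow S u v → ph v ≡ just p → mid v ≡ symbolOf M p
    centred {v = v} s e =
      let _ , _ , _ , _ , _ , c , _ = allowed S s
      in subst (λ p → PhaseCentre M p (mid v)) e c

    phaseStep : ∀ {u v p} → Arrow S u v → ph u ≡ just p →
                ∃ λ p′ → ph v ≡ just p′ × T (mayFollow p p′)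
    phaseStep {u} {v} s e with ph v in e′ | proj₁ (proj₂ (proj₂ (proj₂ (proj₂ (allowed S s)))))
    ... | nothing | h = ⊥-elim (subst (λ p → PhaseStep M p nothing) e h)
    ... | just p′ | h = p′ , refl , subst (λ p → PhaseStep M p (just p′)) e h

    successor : ∀ {u p} → ph u ≡ just p → mid u ≢ rend →
                ∃₂ λ v p′ → Arrow S u v × ph v ≡ just p′ × T (mayFollow p p′)
    successor e ne =
      let v , s = source S ne
          p′ , e′ , h = phaseStep s e
      in v , p′ , s , e′ , h

    data Right : Phase → Set where
      padR    : Right padR
      closing : Right closing

    rank-4 : ∀ p → rank p ≡ 4 → Right p
    rank-4 padR    _ = padR
    rank-4 closing _ = closing
    rank-4 (text prefix _ _)     ()
    rank-4 (text pivot _ _)      ()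
    rank-4 (text (gadget _) _ _) ()
    rank-4 (text (copy _) _ _)   ()

    walk-right : ∀ {u p} → Acc (λ v u → ¬ v ≤ u) u → ph u ≡ just p → Right p →
                 mid u ≡ symbolOf M p → ∃ λ n → Chain u (blanks n ++ [ rend ])
    walk-right a       e closing c = 0 , stop c
    walk-right {u} (acc r) e padR c with successor e (λ e′ → contradiction (trans (sym c) e′) λ ())
    ... | v , padR    , s , e′ , _ = let n , ch = walk-right (r (after s)) e′ padR (centred s e′)
          in suc n , subst (λ c → Chain u (c ∷ blanks n ++ [ rend ])) c (s ∷ ch)
    ... | v , closing , s , e′ , _ = let n , ch = walk-right (r (after s)) e′ closing (centred s e′)
          in suc n , subst (λ c → Chain u (c ∷ blanks n ++ [ rend ])) c (s ∷ ch)

    copyLetter-inv : ∀ {p a} → copyLetter (just p) ≡ just a → ∃₂ λ b as → p ≡ text (copy b) a as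
    copyLetter-inv {text (copy b) a as} refl = b , as , refl

    -- The part of the first row that follows the pivot is read off the pinning formula.
    walk-copy : ∀ w {u} → Follows (spec M) lab (Arrow S) w u →
                ∃ λ n → After u (letterCells w ++ blanks n ++ [ rend ])
    walk-copy [] {u} (v , s , (fin , c)) with ph v in e
    ... | just p = let n , ch = walk-right (rightmost v) e (rank-4 p fin) c
                   in n , s ∷ ch
    walk-copy (a ∷ w) {u} (v , s , (isCopy , c) , h) with ph v
    ... | nothing = contradiction isCopy λ ()
    ... | just p with copyLetter-inv {p} isCopy
    ... | _ , _ , refl = let n , ch = walk-copy w h
          in n , s ∷ subst (λ c → Chain v (c ∷ letterCells w ++ blanks n ++ [ rend ])) c ch

    endOf : Block → Node → Set
    endOf b u = ∃ λ z → ph u ≡ just (text b z []) × mid u ≡ cell (inj₁ z)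

    IsGadget IsCopy : Node → Set
    IsGadget u = Is-just (gadgetLetter (ph u))
    IsCopy u   = Is-just (copyLetter (ph u))

    text-inside : ∀ b a a′ as p → T (mayFollow (text b a (a′ ∷ as)) p) → p ≡ text b a′ as
    text-inside b a a′ as (text c d ds) h with to Boolₚ.T-∧ h
    ... | h₁ , h₂ with toWitness {a? = block-≟ b c} h₁
                     | toWitness {a? = letters-≟ (a′ ∷ as) (d ∷ ds)} h₂
    ... | refl | refl = refl

    inside-gadgetless : ∀ b {a a′ as} → gadgetLetter (just (text b a (a′ ∷ as))) ≡ nothing
    inside-gadgetless prefix     = refl
    inside-gadgetless pivot      = refl
    inside-gadgetless (gadget _) = refl
    inside-gadgetless (copy _)   = refl

    -- Inner letters of a block are not gadget ends, so a gadget end from `u` on cannot lie before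
    -- `v`. This is used to identify sources of H-arrows.
    walk-text : ∀ {u b a} as → ph u ≡ just (text b a as) → mid u ≡ cell (inj₁ a) →
                ∃ λ v → endOf b v × u ≤ v
                  × (∀ {t} → IsGadget t → u ≤ t → v ≤ t)
                  × (∀ {cs} → After v cs → After u (letterCells as ++ cs))
    walk-text {u} [] e c = u , (_ , e , c) , O.refl , (λ _ → id) , id
    walk-text {u} {b} {a} (a′ ∷ as) e c
      with successor e (λ e′ → contradiction (trans (sym c) e′) λ ())
    ... | u′ , p′ , s , e′ , h with text-inside b a a′ as p′ h
    ... | refl =
      let c′ = centred s e′
          v , end , u′≤v , gap , ch = walk-text as e′ c′
      in v , end , O.trans (≰⇒≤ (after s)) u′≤v
       , (λ {t} g u≤t → gap g (from (immediate t s) λ t≤u →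
           not-u (subst IsGadget (O.antisym t≤u u≤t) g)))
       , λ {cs} aft → s ∷ subst (λ c → Chain u′ (c ∷ letterCells as ++ cs)) c′ (ch aft)
      where
      not-u : ¬ IsGadget u
      not-u g with subst Is-just (trans (cong gadgetLetter e) (inside-gadgetless b)) g
      ... | ()

    -- The gadgets up to u are matched with the copied letters up to v.
    Synchronised : Node → Node → Set
    Synchronised u v = ∀ {s t} → Arrow H s t → s ≤ u ⇔ t ≤ v

    data Branch : Phase → Set where
      pivot  : Branch (firstOf pivot)
      gadget : ∀ a → Branch (firstOf (gadget a))

    -- The first hypothesis leaves `prefix` and gadgets for `b`; neither may end the text or precede
    -- a copy.
    branch : ∀ b a p → T (precedes b pivot) → T (mayFollow (text b a []) p) → Branch p
    branch b a (text c d ds) before h with to Boolₚ.T-∧ h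
    ... | h₁ , h₂ with toWitness {a? = letters-≟ (d ∷ ds) letters⟨ c ⟩} h₂
    branch b          a (text pivot _ _)      before h | _  , _ | refl = pivot
    branch b          a (text (gadget c) _ _) before h | _  , _ | refl = gadget c
    branch prefix     a (text prefix _ _)     before h | () , _ | refl
    branch (gadget _) a (text prefix _ _)     before h | () , _ | refl
    branch prefix     a (text (copy _) _ _)   before h | () , _ | refl
    branch (gadget _) a (text (copy _) _ _)   before h | () , _ | refl
    branch prefix     a padR    before ()
    branch (gadget _) a padR    before ()
    branch prefix     a closing before ()
    branch (gadget _) a closing before ()

    gadgetLetter-inv : ∀ {p} → Is-just (gadgetLetter (just p)) →
                       ∃₂ λ a z → p ≡ text (gadget a) z []
    gadgetLetter-inv {text (gadget a) z []} _ = a , z , refl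

    gadget-rank : ∀ {u} → IsGadget u → ∃ λ p → ph u ≡ just p × rank p ≡ 1
    gadget-rank {u} g with ph u
    ... | just p with gadgetLetter-inv {p} g
    ... | _ , _ , refl = _ , refl , refl

    copy-rank : ∀ {u} → IsCopy u → ∃ λ p → ph u ≡ just p × rank p ≡ 3
    copy-rank {u} g with ph u
    ... | just (text (copy _) _ _) = _ , refl , refl

    finish-rank : ∀ {u} → PhasePin M finish (ph u) → ∃ λ p → ph u ≡ just p × rank p ≡ 4
    finish-rank {u} fin with ph u
    ... | just p = p , refl , fin

    rank-clash : ∀ {u v m n} → u ≤ v → (∃ λ p → ph u ≡ just p × rank p ≡ m) →
                 (∃ λ p → ph v ≡ just p × rank p ≡ n) → n ℕ.< m → ⊥
    rank-clash u≤v (_ , e , refl) (_ , e′ , refl) = ℕₚ.≤⇒≯ (rank-≤ u≤v e e′)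

    walk-block : ∀ c {u u′} → Arrow S u u′ → ph u′ ≡ just (firstOf c) →
      ∃ λ t → endOf c t × ¬ t ≤ u
        × (∀ {α} → IsGadget α → ¬ α ≤ u → t ≤ α)
        × (∀ {cs} → After t cs → After u (letterCells letters⟨ c ⟩ ++ cs))
    walk-block c {u} {u′} s e =
      let mid≡ = centred s e
          t , end , u′≤t , gap , ch = walk-text (proj₂ (word c)) e mid≡
      in t , end , to (immediate t s) u′≤t
       , (λ {α} g α≰u → gap g (from (immediate α s) α≰u))
       , λ {cs} aft → s ∷ subst (λ m → Chain u′ (m ∷ letterCells (proj₂ (word c)) ++ cs)) mid≡ (ch aft)

    ends-gadget : ∀ {a u} → endOf (gadget a) u → gadgetLetter (ph u) ≡ just a
    ends-gadget (_ , e , _) = cong gadgetLetter e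

    linked : ∀ {u v} → Arrow H u v → IsGadget u × IsCopy v
    linked {u} {v} r = let g , e = allowed H r in g , subst Is-just e g

    -- Gadgets after `u` and copied letters after `v` are consumed in parallel. The H-arrows force
    -- both sequences to have the same length and the same letters, and `Follows` says that the
    -- copied letters are `w`.
    walk-gadgets : ∀ w {u v b} → T (precedes b pivot) → endOf b u → Synchronised u v →
      Follows (spec M) lab (Arrow S) w v →
      ∃ λ t → endOf pivot t × (∀ {cs} → After t cs → After u (letterCells (encode (follow w)) ++ cs))
    walk-gadgets w {u} {v} {b} before (z , e , c) sync follows
      with successor e (λ e′ → contradiction (trans (sym c) e′) λ ())
    ... | u′ , p′ , s , e′ , h with branch b z p′ before h
    walk-gadgets [] before (z , e , c) sync (v′ , s′ , (fin , _)) | u′ , _ , s , e′ , _ | pivot =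
      let t , end , _ , _ , ch = walk-block pivot s e′ in t , end , ch
    walk-gadgets (a ∷ w) before (z , e , c) sync (v′ , s′ , (cop , _) , _)
      | u′ , _ , s , e′ , _ | pivot =
      -- Too few gadgets: the gadget matched with `v′` lies beyond `u`, hence not before the pivot,
      -- although its rank is 1 and that of the pivot is 2.
      let α , r = target H {v′} (≡just⇒Is-just cop)
          α≰u = after s′ ∘ to (sync r)
      in ⊥-elim (rank-clash (from (immediate α s) α≰u) (_ , e′ , refl)
           (gadget-rank (proj₁ (linked r))) (ℕₚ.≤-refl {2}))
    walk-gadgets [] before (z , e , c) sync (v′ , s′ , (fin , _))
      | u′ , _ , s , e′ , _ | gadget d =
      let t , end , t≰u , _ , _ = walk-block (gadget d) s e′
          -- Too many gadgets: the copy matched with `t` lies beyond `v`, hence not before `v′`,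
          -- although its rank is 3 and that of `v′` is 4.
          β , r = source H {t} (≡just⇒Is-just (ends-gadget end))
          β≰v = t≰u ∘ from (sync r)
      in ⊥-elim (rank-clash (from (immediate β s′) β≰v) (finish-rank fin)
           (copy-rank (proj₂ (linked r))) (ℕₚ.≤-refl {4}))
    walk-gadgets (a ∷ w) {u} before (z , e , c) sync (v′ , s′ , (cop , _) , h)
      | u′ , _ , s , e′ , _ | gadget d =
      let t , end , t≰u , gap , ch = walk-block (gadget d) s e′
          β , r = source H {t} (≡just⇒Is-just (ends-gadget end))
          α , r′ = target H {v′} (≡just⇒Is-just cop)
          v′≤β = from (immediate β s′) (t≰u ∘ from (sync r))
          -- The preimage `α` of `v′` lies beyond `u`, and `t` is the first gadget end there.
          -- Conversely `v′` is at most the image `β` of `t`, so `α` is at most `t`.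
          t≡α = O.antisym (gap (proj₁ (linked r′)) (after s′ ∘ to (sync r′)))
                          (from (mono H r′ r) v′≤β)
          d≡a = just-injective (trans (sym (ends-gadget end))
                  (trans (cong (gadgetLetter ∘ ph) t≡α) (trans (proj₂ (allowed H r′)) cop)))
          t′ , end′ , ch′ = walk-gadgets w {t} {v′} {gadget d} tt end
            -- Now `t` and `v′` are joined by an H-arrow, so monotonicity synchronises them.
            (λ q → mono H q (subst (λ t → Arrow H t v′) (sym t≡α) r′)) h
      in t′ , end′ , λ {cs} aft →
           subst (After u)
             (trans (sym (Listₚ.++-assoc (letterCells letters⟨ gadget d ⟩) (letterCells (encode (follow w))) cs))
               (cong (_++ cs) (trans (sym (Listₚ.map-++ (cell ∘ inj₁) letters⟨ gadget d ⟩ (encode (follow w))))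
                 (cong (λ a → letterCells (letters⟨ gadget a ⟩ ++ encode (follow w))) d≡a))))
             (ch (ch′ aft))

    data Left : Phase → Set where
      opening : Left opening
      padL    : Left padL

    walk-left : ∀ {u p} → Acc (λ v u → ¬ v ≤ u) u → ph u ≡ just p → Left p → mid u ≢ rend →
                ∃₂ λ n t → ph t ≡ just edge × mid t ≡ symbolOf M edge
                   × (∀ {cs} → Chain t cs → After u (blanks n ++ cs))
    walk-left {u} (acc r) e l ne with successor e ne
    walk-left {u} (acc r) e opening ne | v , edge , s , e′ , _ = 0 , v , e′ , centred s e′ , (s ∷_)
    walk-left {u} (acc r) e padL    ne | v , edge , s , e′ , _ = 0 , v , e′ , centred s e′ , (s ∷_)
    walk-left {u} (acc r) e l    ne | v , padL , s , e′ , _ =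
      let c = centred s e′
          n , t , e″ , m , ch = walk-left (r (after s)) e′ padL (λ e → contradiction (trans (sym c) e) λ ())
      in suc n , t , e″ , m , λ {cs} chain → s ∷ subst (λ c → Chain v (c ∷ blanks n ++ cs)) c (ch chain)

    first-row : ∃₂ λ i j → ∃ λ u →
      Chain u (lend ∷ blanks i ++ head start (inj₁ univ) ∷
        letterCells (letters⟨ prefix ⟩ ++ encode (follow w) ++ w) ++ blanks j ++ [ rend ])
    first-row =
      let u , e , c = hasOrigin
          mid-u = subst (λ p → PhaseCentre M p (mid u)) e c
          i , t , e-t , mid-t , ch = walk-left (rightmost u) e opening
            (λ e → contradiction (trans (sym mid-u) e) λ ())
          t′ , p′ , s , e-t′ , h = successor e-t (λ e → contradiction (trans (sym mid-t) e) λ ())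
          v , end , _ , _ , ch₁ = walk-block prefix s (trans e-t′ (cong just (edge-inv h)))
          e₀ , turning , _ = hasTurn
          -- Initially both sides of the synchronisation are false: up to the end of the prefix the
          -- ranks exclude gadgets, and up to the turn `e₀` they exclude copies.
          v′ , end′ , ch₂ = walk-gadgets w {v} {e₀} {prefix} tt end
            (λ r → mk⇔
              (λ x≤v → ⊥-elim (rank-clash x≤v (gadget-rank (proj₁ (linked r)))
                                 (_ , proj₁ (proj₂ end) , refl) (ℕₚ.≤-refl {1})))
              (λ y≤e₀ → ⊥-elim (rank-clash y≤e₀ (copy-rank (proj₂ (linked r)))
                                  (turn-rank turning) (ℕₚ.≤-refl {3}))))
            (follows (proj₂ hasTurn))
          -- `follows` holds at every turn node, so it applies to the pivot end `v′` reached by the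
          -- walk without comparing it with `e₀`.
          j , ch₃ = walk-copy w (follows {v′} (turn-end end′))
      in i , j , u
       , subst₂ (λ c cs → Chain u (c ∷ blanks i ++ cs)) mid-u
           (trans (cong (_∷ letterCells letters⟨ prefix ⟩ ++ letterCells (encode (follow w)) ++
                        letterCells w ++ blanks j ++ [ rend ]) mid-t)
             (cong (head start (inj₁ univ) ∷_) (joined (blanks j ++ [ rend ]))))
           (ch (ch₁ (ch₂ ch₃)))
      where
      edge-inv : ∀ {p} → T (mayFollow edge p) → p ≡ firstOf prefix
      edge-inv {text prefix a as} h with toWitness {a? = letters-≟ (a ∷ as) letters⟨ prefix ⟩} h
      ... | refl = refl
      turn-rank : ∀ {u} → PhasePin M turn (ph u) → ∃ λ p → ph u ≡ just p × rank p ≡ 2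
      turn-rank {u} h with ph u
      ... | just (text pivot _ []) = _ , refl , refl
      turn-end : ∀ {u} → endOf pivot u → PhasePin M turn (ph u) × PhaseCentre M (ph u) (mid u)
      turn-end {u} (z , e , c) = subst (PhasePin M turn) (sym e) tt
                               , subst (λ p → PhaseCentre M p (mid u)) (sym e) c
      joined : ∀ cs → letterCells letters⟨ prefix ⟩ ++ letterCells (encode (follow w)) ++ letterCells w ++ cs
               ≡ letterCells (letters⟨ prefix ⟩ ++ encode (follow w) ++ w) ++ cs
      joined cs = sym (trans (cong (_++ cs)
          (trans (Listₚ.map-++ (cell ∘ inj₁) letters⟨ prefix ⟩ (encode (follow w) ++ w))
            (cong (letterCells letters⟨ prefix ⟩ ++_)
              (Listₚ.map-++ (cell ∘ inj₁) (encode (follow w)) w))))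
        (trans (Listₚ.++-assoc (letterCells letters⟨ prefix ⟩) (letterCells (encode (follow w)) ++ letterCells w) cs)
          (cong (letterCells letters⟨ prefix ⟩ ++_)
            (Listₚ.++-assoc (letterCells (encode (follow w))) (letterCells w) cs))))

    rejects : ¬ Run M start (initial M (univ ∷ letters⟨ prefix ⟩ ++ encode (follow w) ++ w)) true
    rejects run =
      let i , j , u , ch = first-row
      in no-run run i j (subst (Chain u) (sym (rowOf-initial i univ _ j)) ch)

  satisfiable⇒¬accepts : FinitelySatisfiable (φ M) → ¬ HaltsWith M (encode (proj₁ (φ M))) true
  satisfiable⇒¬accepts (𝔄 , tp₁ , tp₂ , sat) =
    -- The word of `φ M` computes to the input in `rejects`, because the letters in front of
    -- `follow` form a closed list.
    let open Extraction (spec M) 𝔄 tp₁ tp₂ sat in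
    Soundness.rejects totalOrder rightmost diagram

-- Lists as functions of the position

module _ {A : Set} (d : A) where

  at : List A → ℕ → A
  at []       _       = d
  at (a ∷ as) zero    = a
  at (a ∷ as) (suc c) = at as c

  at-beyond : ∀ as {c} → length as ℕ.≤ c → at as c ≡ d
  at-beyond []       _           = refl
  at-beyond (_ ∷ as) (ℕ.s≤s as≤c) = at-beyond as as≤c

  at-within : ∀ {as c} → at as c ≢ d → c ℕ.< length as
  at-within {as} {c} ne with c ℕₚ.<? length as
  ... | yes h = h
  ... | no  h = contradiction (at-beyond as (ℕₚ.≮⇒≥ h)) ne

  at-All : ∀ {Q : A → Set} {as} → All Q as → Q d → ∀ c → Q (at as c)
  at-All []       q c       = q
  at-All (h ∷ _)  q zero    = h
  at-All (_ ∷ hs) q (suc c) = at-All hs q c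

at-map : ∀ {A B : Set} (f : A → B) d as c → at (f d) (map f as) c ≡ f (at d as c)
at-map f d []       c       = refl
at-map f d (_ ∷ _)  zero    = refl
at-map f d (_ ∷ as) (suc c) = at-map f d as c

-- The number of elements selected by f among the first c ones is the position in
-- mapMaybe f as of a selected element with position c.
module _ {A B : Set} (f : A → Maybe B) where

  count : List A → ℕ → ℕ
  count []       c       = 0
  count (a ∷ as) zero    = 0
  count (a ∷ as) (suc c) with f a
  ... | just _  = suc (count as c)
  ... | nothing = count as c

  module _ {d : A} (f-d : f d ≡ nothing) where

    selected : ∀ as c {b} → f (at d as c) ≡ just b →
               at nothing (map just (mapMaybe f as)) (count as c) ≡ just b
    selected []       c       e with () ← trans (sym f-d) e
    selected (a ∷ as) zero    e with f a
    selected (a ∷ as) zero    e | just _ = e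
    selected (a ∷ as) (suc c) e with f a
    ... | just _  = selected as c e
    ... | nothing = selected as c e

    selects : ∀ as k {b} → at nothing (map just (mapMaybe f as)) k ≡ just b →
              ∃ λ c → f (at d as c) ≡ just b × count as c ≡ k
    selects (a ∷ as) k e with f a in eq
    selects (a ∷ as) zero    e | just b = 0 , trans eq e , refl
    selects (a ∷ as) (suc k) e | just b with selects as k e
    ... | c , e′ , refl = suc c , e′ , count-just eq
      where
      count-just : ∀ {b} → f a ≡ just b → count (a ∷ as) (suc c) ≡ suc (count as c)
      count-just eq rewrite eq = refl
    selects (a ∷ as) k e | nothing with selects as k e
    ... | c , e′ , refl = suc c , e′ , count-nothing eq
      where
      count-nothing : f a ≡ nothing → count (a ∷ as) (suc c) ≡ count as c
      count-nothing eq rewrite eq = refl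

    count-mono-< : ∀ as {c c′} → Is-just (f (at d as c)) → c ℕ.< c′ → count as c ℕ.< count as c′
    count-mono-< []       h _ with () ← subst Is-just f-d h
    count-mono-< (a ∷ as) {zero}  {suc c′} h _ with f a
    ... | just _ = ℕ.s≤s ℕ.z≤n
    count-mono-< (a ∷ as) {suc c} {suc c′} h (ℕ.s≤s c<c′) with f a
    ... | just _  = ℕ.s≤s (count-mono-< as h c<c′)
    ... | nothing = count-mono-< as h c<c′

    count-cancel-≤ : ∀ as {c c′} → Is-just (f (at d as c′)) → count as c ℕ.≤ count as c′ → c ℕ.≤ c′
    count-cancel-≤ as h le = ℕₚ.≮⇒≥ λ c′<c → ℕₚ.<⇒≱ (count-mono-< as h c′<c) le

    count-mono-≤ : ∀ as {c c′} → Is-just (f (at d as c)) → c ℕ.≤ c′ → count as c ℕ.≤ count as c′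
    count-mono-≤ as h c≤c′ with ℕₚ.m≤n⇒m<n∨m≡n c≤c′
    ... | inj₁ c<c′ = ℕₚ.<⇒≤ (count-mono-< as h c<c′)
    ... | inj₂ refl = ℕₚ.≤-refl

-- The phases of the first row

data Path : Phase → List Phase → Set where
  []  : ∀ {p} → Path p []
  _∷_ : ∀ {p q qs} → T (mayFollow p q) → Path q qs → Path p (q ∷ qs)

mayFollow⇒rank≤ : ∀ p q → T (mayFollow p q) → rank p ℕ.≤ rank q
mayFollow⇒rank≤ opening q        _ = ℕ.z≤n
mayFollow⇒rank≤ padL    q        _ = ℕ.z≤n
mayFollow⇒rank≤ edge    q        _ = ℕ.z≤n
mayFollow⇒rank≤ padR    padR     _ = ℕₚ.≤-refl
mayFollow⇒rank≤ padR    closing  _ = ℕₚ.≤-refl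
mayFollow⇒rank≤ (text prefix     _ _)       q                   h = ℕ.z≤n
mayFollow⇒rank≤ (text b          _ (a ∷ as)) (text c d ds)      h
  with refl ← toWitness {a? = block-≟ b c} (proj₁ (to Boolₚ.T-∧ h)) = ℕₚ.≤-reflexive (same b)
  where
  same : ∀ b {a as a′ as′} → rank (text b a as) ≡ rank (text b a′ as′)
  same prefix     = refl
  same (gadget _) = refl
  same pivot      = refl
  same (copy _)   = refl
mayFollow⇒rank≤ (text (gadget _) _ [])      (text (gadget _) _ _) h = ℕₚ.≤-refl
mayFollow⇒rank≤ (text (gadget _) _ [])      (text pivot _ _)      h = ℕₚ.n≤1+n 1
mayFollow⇒rank≤ (text pivot _ [])           (text (copy _) _ _)   h = ℕₚ.n≤1+n 2
mayFollow⇒rank≤ (text (copy _) _ [])        (text (copy _) _ _)   h = ℕₚ.≤-refl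
mayFollow⇒rank≤ (text pivot _ [])           padR                  h = ℕₚ.m≤n+m 2 2
mayFollow⇒rank≤ (text pivot _ [])           closing               h = ℕₚ.m≤n+m 2 2
mayFollow⇒rank≤ (text (copy _) _ [])        padR                  h = ℕₚ.n≤1+n 3
mayFollow⇒rank≤ (text (copy _) _ [])        closing               h = ℕₚ.n≤1+n 3

rank≤4 : ∀ p → rank p ℕ.≤ 4
rank≤4 opening               = ℕ.z≤n
rank≤4 padL                  = ℕ.z≤n
rank≤4 edge                  = ℕ.z≤n
rank≤4 (text prefix _ _)     = ℕ.z≤n
rank≤4 (text (gadget _) _ _) = ℕₚ.m≤n+m 1 3
rank≤4 (text pivot _ _)      = ℕₚ.m≤n+m 2 2
rank≤4 (text (copy _) _ _)   = ℕₚ.n≤1+n 3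
rank≤4 padR                  = ℕₚ.≤-refl
rank≤4 closing               = ℕₚ.≤-refl

phaseAt : List Phase → ℕ → Phase
phaseAt = at closing

Path-at : ∀ {p ps} → Path p ps → ∀ c → c ℕ.< length ps → T (mayFollow (phaseAt (p ∷ ps) c) (phaseAt ps c))
Path-at (h ∷ _)   zero    _           = h
Path-at (_ ∷ path) (suc c) (ℕ.s≤s c<n) = Path-at path c c<n

Path-rank-suc : ∀ {p ps} → Path p ps → ∀ c → rank (phaseAt (p ∷ ps) c) ℕ.≤ rank (phaseAt ps c)
Path-rank-suc {p} {ps} path c with c ℕₚ.<? length ps
... | yes c<n = mayFollow⇒rank≤ _ _ (Path-at path c c<n)
-- Beyond the list the default `closing` has the greatest rank.
... | no  c≮n = ℕₚ.≤-trans (rank≤4 (phaseAt (p ∷ ps) c))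
                  (ℕₚ.≤-reflexive (sym (cong rank (at-beyond closing ps (ℕₚ.≮⇒≥ c≮n)))))

Path-rank : ∀ {p ps} → Path p ps → ∀ {c c′} → c ℕ.≤ c′ →
            rank (phaseAt (p ∷ ps) c) ℕ.≤ rank (phaseAt (p ∷ ps) c′)
Path-rank {p} {ps} path {c} c≤c′ with ℕₚ.m≤n⇒∃[o]m+o≡n c≤c′
... | k , refl = go k
  where
  go : ∀ k → rank (phaseAt (p ∷ ps) c) ℕ.≤ rank (phaseAt (p ∷ ps) (c + k))
  go zero    rewrite ℕₚ.+-identityʳ c = ℕₚ.≤-refl
  go (suc k) rewrite ℕₚ.+-suc c k = ℕₚ.≤-trans (go k) (Path-rank-suc path (c + k))

rightPhases : ℕ → List Phase
rightPhases j = replicate j padR ++ [ closing ]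

copyPhases : List Letter → List Phase
copyPhases = map λ a → text (copy a) a []

gadgetPhases : List Letter → List Phase → List Phase
gadgetPhases []      qs = qs
gadgetPhases (a ∷ w) qs = textOf (gadget a) ++ gadgetPhases w qs

tailPhases : List Letter → ℕ → List Phase
tailPhases w j = copyPhases w ++ rightPhases j

leftPhases : ℕ → List Letter → ℕ → List Phase
leftPhases i w j =
  replicate i padL ++ edge ∷ textOf prefix ++ gadgetPhases w (textOf pivot ++ tailPhases w j)

initialPhases : ℕ → List Letter → ℕ → List Phase
initialPhases i w j = opening ∷ leftPhases i w j

path-right : ∀ p j → T (mayFollow p padR) → T (mayFollow p closing) → Path p (rightPhases j)
path-right p zero    h h′ = h′ ∷ []
path-right p (suc j) h h′ = h ∷ path-right padR j tt tt

path-text : ∀ {p qs} b a as → T (mayFollow p (text b a as)) →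
            (∀ z → Path (text b z []) qs) → Path p (textFrom b a as ++ qs)
path-text b a []        h path = h ∷ path a
path-text b a (a′ ∷ as) h path = h ∷
  path-text b a′ as (from Boolₚ.T-∧ (fromWitness {a? = block-≟ b b} refl
                                    , fromWitness {a? = letters-≟ (a′ ∷ as) (a′ ∷ as)} refl)) path

path-block : ∀ {b z qs} c → T (precedes b c) → (∀ z → Path (text c z []) qs) →
             Path (text b z []) (textOf c ++ qs)
path-block c h = path-text c (proj₁ (word c)) (proj₂ (word c))
  (from Boolₚ.T-∧ (h , fromWitness {a? = letters-≟ letters⟨ c ⟩ letters⟨ c ⟩} refl))

path-copies : ∀ w {b} z j → T (precedes b (copy 𝕩)) → T (ends b) →
              Path (text b z []) (tailPhases w j)
path-copies []      z j h e = path-right _ j e e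
path-copies (a ∷ w) {b} z j h e = path-block {b} (copy a) (any b h) λ z → path-copies w z j tt tt
  where
  any : ∀ b → T (precedes b (copy 𝕩)) → T (precedes b (copy a))
  any pivot    _ = tt
  any (copy _) _ = tt

path-gadgets : ∀ w {b qs} z → T (precedes b pivot) → (∀ z → Path (text pivot z []) qs) →
               Path (text b z []) (gadgetPhases w (textOf pivot ++ qs))
path-gadgets []      {b} z h path = path-block {b} pivot h path
path-gadgets (a ∷ w) {b} z h path = path-block {b} (gadget a) (any b h) λ z → path-gadgets w z tt path
  where
  any : ∀ b → T (precedes b pivot) → T (precedes b (gadget a))
  any prefix     _ = tt
  any (gadget _) _ = tt

path-initial : ∀ i w j → Path opening (leftPhases i w j)
path-initial i w j = go i opening tt tt
  where
  go : ∀ i p → T (mayFollow p padL) → T (mayFollow p edge) → Path p (leftPhases i w j)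
  go zero    p h h′ = h′ ∷ path-text prefix (proj₁ (word prefix)) (proj₂ (word prefix))
    (fromWitness {a? = letters-≟ letters⟨ prefix ⟩ letters⟨ prefix ⟩} refl)
    λ z → path-gadgets w z tt λ z → path-copies w z j tt tt
  go (suc i) p h h′ = h ∷ go i padL tt tt

IsTurn : Phase → Set
IsTurn (text pivot _ []) = ⊤
IsTurn _                 = ⊥

-- The position of the turn is not computed: it is enough that one exists and that `qs` is read
-- behind any such position.
record TurnBefore (qs ps : List Phase) : Set where
  constructor _,_
  field
    turning : ∃ (IsTurn ∘ phaseAt ps)
    onward  : ∀ k → IsTurn (phaseAt ps k) → ∀ c → phaseAt ps (suc k + c) ≡ phaseAt qs c

turn-here : ∀ {z qs} → (∀ k → ¬ IsTurn (phaseAt qs k)) → TurnBefore qs (text pivot z [] ∷ qs)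
turn-here none = (0 , tt) , λ { zero _ c → refl ; (suc k) h c → contradiction h (none k) }

turn-∷ : ∀ {p ps qs} → ¬ IsTurn p → TurnBefore qs ps → TurnBefore qs (p ∷ ps)
turn-∷ no-turn ((k , h) , after) =
  (suc k , h) , λ { zero h c → contradiction h no-turn ; (suc k) h c → after k h c }

turnless-inside : ∀ b {a a′ as} → ¬ IsTurn (text b a (a′ ∷ as))
turnless-inside prefix     ()
turnless-inside (gadget _) ()
turnless-inside pivot      ()
turnless-inside (copy _)   ()

turn-text : ∀ b {ps qs} a as → (∀ z → TurnBefore qs (text b z [] ∷ ps)) →
            TurnBefore qs (textFrom b a as ++ ps)
turn-text b a []        h = h a
turn-text b a (a′ ∷ as) h = turn-∷ (turnless-inside b) (turn-text b a′ as h)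

turn-gadgets : ∀ w {ps qs} → TurnBefore qs ps → TurnBefore qs (gadgetPhases w ps)
turn-gadgets []      h = h
turn-gadgets (a ∷ w) h = turn-text (gadget a) (proj₁ (word (gadget a))) (proj₂ (word (gadget a)))
  λ _ → turn-∷ (λ ()) (turn-gadgets w h)

turn-initial : ∀ i w j → TurnBefore (tailPhases w j) (initialPhases i w j)
turn-initial i w j = turn-∷ (λ ()) (go i)
  where
  turnless-right : ∀ j k → ¬ IsTurn (phaseAt (rightPhases j) k)
  turnless-right zero    zero    ()
  turnless-right zero    (suc k) ()
  turnless-right (suc j) zero    ()
  turnless-right (suc j) (suc k) h = turnless-right j k h
  turnless : ∀ w k → ¬ IsTurn (phaseAt (tailPhases w j) k)
  turnless []      k       h = turnless-right j k h
  turnless (_ ∷ w) zero    ()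
  turnless (_ ∷ w) (suc k) h = turnless w k h
  go : ∀ i → TurnBefore (tailPhases w j) (leftPhases i w j)
  go zero = turn-∷ (λ ()) (turn-text prefix (proj₁ (word prefix)) (proj₂ (word prefix))
    λ _ → turn-∷ (λ ()) (turn-gadgets w (turn-text pivot (proj₁ (word pivot)) (proj₂ (word pivot)) λ _ → turn-here (turnless w))))
  go (suc i) = turn-∷ (λ ()) (go i)

gadgetOf copyOf : Phase → Maybe Letter
gadgetOf p = gadgetLetter (just p)
copyOf p   = copyLetter (just p)

-- If inner letters select nothing, a block contributes to `mapMaybe` only through its last phase.
select-text : ∀ {f : Phase → Maybe Letter} b a as qs →
              (∀ {a a′ as} → f (text b a (a′ ∷ as)) ≡ nothing) →
              ∃ λ z → mapMaybe f (textFrom b a as ++ qs) ≡ mapMaybe f (text b z [] ∷ qs)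
select-text b a []        qs e = a , refl
select-text {f} b a (a′ ∷ as) qs e with f (text b a (a′ ∷ as)) | e {a} {a′} {as}
... | nothing | _ = select-text b a′ as qs e

select-block : ∀ {f : Phase → Maybe Letter} b qs →
               (∀ {a a′ as} → f (text b a (a′ ∷ as)) ≡ nothing) →
               ∃ λ z → mapMaybe f (textOf b ++ qs) ≡ mapMaybe f (text b z [] ∷ qs)
select-block b = select-text b (proj₁ (word b)) (proj₂ (word b))

select-right : ∀ {f : Phase → Maybe Letter} j → f padR ≡ nothing → f closing ≡ nothing →
               mapMaybe f (rightPhases j) ≡ []
select-right zero    e e′ rewrite e′ = refl
select-right (suc j) e e′ rewrite e = select-right j e e′

select-left : ∀ {f : Phase → Maybe Letter} i {qs} → f padL ≡ nothing →
              mapMaybe f (replicate i padL ++ qs) ≡ mapMaybe f qs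
select-left zero    e = refl
select-left (suc i) e rewrite e = select-left i e

-- With `copies-initial`, gadgets and copies spell the same word, so matching them by ordinal number
-- respects letters.
gadgets-initial : ∀ i w j → mapMaybe gadgetOf (initialPhases i w j) ≡ w
gadgets-initial i w j =
  trans (select-left {gadgetOf} i refl) (trans
    (proj₂ (select-block {gadgetOf} prefix (gadgetPhases w (textOf pivot ++ tailPhases w j)) refl))
    (gadgets w))
  where
  copies : ∀ w → mapMaybe gadgetOf (tailPhases w j) ≡ []
  copies []      = select-right {gadgetOf} j refl refl
  copies (_ ∷ w) = copies w
  gadgets : ∀ w′ → mapMaybe gadgetOf (gadgetPhases w′ (textOf pivot ++ tailPhases w j)) ≡ w′
  gadgets []      = trans (proj₂ (select-block {gadgetOf} pivot (tailPhases w j) refl)) (copies w)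
  gadgets (a ∷ w′) = trans
    (proj₂ (select-block {gadgetOf} (gadget a) (gadgetPhases w′ (textOf pivot ++ tailPhases w j)) refl))
    (cong (a ∷_) (gadgets w′))

copies-initial : ∀ i w j → mapMaybe copyOf (initialPhases i w j) ≡ w
copies-initial i w j =
  trans (select-left {copyOf} i refl) (trans
    (proj₂ (select-block {copyOf} prefix (gadgetPhases w (textOf pivot ++ tailPhases w j)) refl))
    (gadgets w))
  where
  copies : ∀ w → mapMaybe copyOf (tailPhases w j) ≡ w
  copies []      = select-right {copyOf} j refl refl
  copies (a ∷ w) = cong (a ∷_) (copies w)
  gadgets : ∀ w′ → mapMaybe copyOf (gadgetPhases w′ (textOf pivot ++ tailPhases w j)) ≡ w
  gadgets []      = trans (proj₂ (select-block {copyOf} pivot (tailPhases w j) refl)) (copies w)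
  gadgets (a ∷ w′) = trans
    (proj₂ (select-block {copyOf} (gadget a) (gadgetPhases w′ (textOf pivot ++ tailPhases w j)) refl))
    (gadgets w′)

text∈phases : ∀ b → All (_∈ phases) (textOf b)
text∈phases b = All.tabulate (textOf⊆phases b)

closing∈phases : closing ∈ phases
closing∈phases = there (there (there (there (here refl))))

initial∈phases : ∀ i w j → All (_∈ phases) (initialPhases i w j)
initial∈phases i w j = here refl ∷ onLeft i
  where
  onRight : ∀ j → All (_∈ phases) (rightPhases j)
  onRight zero    = closing∈phases ∷ []
  onRight (suc j) = there (there (there (here refl))) ∷ onRight j
  copies : ∀ w → All (_∈ phases) (tailPhases w j)
  copies []      = onRight j
  copies (a ∷ w) = textOf⊆phases (copy a) (here refl) ∷ copies w
  gadgets : ∀ w′ → All (_∈ phases) (gadgetPhases w′ (textOf pivot ++ tailPhases w j))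
  gadgets []       = Allₚ.++⁺ (text∈phases pivot) (copies w)
  gadgets (a ∷ w′) = Allₚ.++⁺ (text∈phases (gadget a)) (gadgets w′)
  onLeft : ∀ i → All (_∈ phases) (leftPhases i w j)
  onLeft zero    = there (there (here refl)) ∷ Allₚ.++⁺ (text∈phases prefix) (gadgets w)
  onLeft (suc i) = there (here refl) ∷ onLeft i

-- The symbols of the first row.

module _ (M : TuringMachine) where
  open TuringMachine M

  symbols-text : ∀ b a as qs → map (symbolOf M) (textFrom b a as ++ qs) ≡
                 letterCells M (a ∷ as) ++ map (symbolOf M) qs
  symbols-text b a []        qs = refl
  symbols-text b a (a′ ∷ as) qs = cong (cell (inj₁ a) ∷_) (symbols-text b a′ as qs)

  symbols-block : ∀ b qs → map (symbolOf M) (textOf b ++ qs) ≡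
                  letterCells M letters⟨ b ⟩ ++ map (symbolOf M) qs
  symbols-block b = symbols-text b (proj₁ (word b)) (proj₂ (word b))

  symbols-initial : ∀ i w j → map (symbolOf M) (initialPhases i w j) ≡
    lend ∷ blanks M i ++ head start (inj₁ univ) ∷
      letterCells M (letters⟨ prefix ⟩ ++ encode (follow w) ++ w) ++ blanks M j ++ [ rend ]
  symbols-initial i w j = cong (lend ∷_) (onLeft i)
    where
    onRight : ∀ j → map (symbolOf M) (rightPhases j) ≡ blanks M j ++ [ rend ]
    onRight zero    = refl
    onRight (suc j) = cong (cell blank ∷_) (onRight j)
    copies : ∀ w → map (symbolOf M) (tailPhases w j) ≡ letterCells M w ++ blanks M j ++ [ rend ]
    copies []      = onRight j
    copies (a ∷ w) = cong (cell (inj₁ a) ∷_) (copies w)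
    split : ∀ u v cs → letterCells M u ++ letterCells M v ++ cs ≡ letterCells M (u ++ v) ++ cs
    split u v cs = trans (sym (Listₚ.++-assoc (letterCells M u) (letterCells M v) cs))
      (cong (_++ cs) (sym (Listₚ.map-++ (cell ∘ inj₁) u v)))
    gadgets : ∀ w′ → map (symbolOf M) (gadgetPhases w′ (textOf pivot ++ tailPhases w j)) ≡
              letterCells M (encode (follow w′) ++ w) ++ blanks M j ++ [ rend ]
    gadgets []       = trans (symbols-block pivot _)
      (trans (cong (letterCells M letters⟨ pivot ⟩ ++_) (copies w))
        (split letters⟨ pivot ⟩ w _))
    gadgets (a ∷ w′) = trans (symbols-block (gadget a) _)
      (trans (cong (letterCells M letters⟨ gadget a ⟩ ++_) (gadgets w′))
        (trans (split letters⟨ gadget a ⟩ (encode (follow w′) ++ w) _)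
          (cong (λ v → letterCells M v ++ blanks M j ++ [ rend ])
            (sym (Listₚ.++-assoc letters⟨ gadget a ⟩ (encode (follow w′)) w)))))
    onLeft : ∀ i → map (symbolOf M) (leftPhases i w j) ≡ blanks M i ++ head start (inj₁ univ) ∷
      letterCells M (letters⟨ prefix ⟩ ++ encode (follow w) ++ w) ++ blanks M j ++ [ rend ]
    onLeft zero    = cong (head start (inj₁ univ) ∷_) (trans (symbols-block prefix _)
      (trans (cong (letterCells M letters⟨ prefix ⟩ ++_) (gadgets w))
        (split letters⟨ prefix ⟩ (encode (follow w) ++ w) _)))
    onLeft (suc i) = cong (cell blank ∷_) (onLeft i)

-- Histories of rejecting runs.

module _ (M : TuringMachine) where
  open TuringMachine M
  open Tag

  first-at : ∀ cs → first M cs ≡ at rend cs 0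
  first-at []      = refl
  first-at (_ ∷ _) = refl

  evolves-at : ∀ {l cs ds} → Evolves M l cs ds → ∀ c → c ℕ.< length cs →
    evolve M (at rend (l ∷ cs) c) (at rend cs c) (at rend cs (suc c)) ≡ just (at rend ds c)
  evolves-at {l} {a ∷ cs} (e ∷ _) zero _ =
    subst (λ b → evolve M l a b ≡ _) (first-at cs) e
  evolves-at (_ ∷ es) (suc c) (ℕ.s≤s c<n) = evolves-at es c c<n

  evolves-length : ∀ {l cs ds} → Evolves M l cs ds → length ds ≡ length cs
  evolves-length []       = refl
  evolves-length (_ ∷ es) = cong suc (evolves-length es)

  -- The bound covers the last position as well as all later ones, where `at` returns its default
  -- `rend`.
  EndsWithRend : List (Symbol M) → Set
  EndsWithRend cs = ∀ c → length cs ℕ.≤ suc c → at rend cs c ≡ rend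

  evolves-rend : ∀ {l cs ds} → Evolves M l cs ds → EndsWithRend cs → EndsWithRend ds
  evolves-rend {l} {cs} {ds} es h c n≤ with c ℕₚ.<? length cs
  ... | yes c<n = evolve-rend⁻ M {at rend (l ∷ cs) c} {at rend cs (suc c)}
                    (subst (λ b → evolve M (at rend (l ∷ cs) c) b (at rend cs (suc c)) ≡ just (at rend ds c))
                      (h c (subst (ℕ._≤ _) (evolves-length es) n≤))
                      (evolves-at es c c<n))
  ... | no  c≮n = at-beyond rend ds (ℕₚ.≤-trans (ℕₚ.≤-reflexive (evolves-length es)) (ℕₚ.≮⇒≥ c≮n))

  data EndsIn : List (Symbol M) → Set where
    here  : EndsIn [ rend ]
    there : ∀ {c cs} → EndsIn cs → EndsIn (c ∷ cs)

  endsIn-++ : ∀ cs {ds} → EndsIn ds → EndsIn (cs ++ ds)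
  endsIn-++ []       e = e
  endsIn-++ (_ ∷ cs) e = there (endsIn-++ cs e)

  endsIn⇒ : ∀ {cs} → EndsIn cs → EndsWithRend cs
  endsIn⇒ here      zero    _          = refl
  endsIn⇒ here      (suc _) _          = refl
  endsIn⇒ (there e) (suc c) (ℕ.s≤s n≤) = endsIn⇒ e c n≤
  endsIn⇒ (there here)      zero (ℕ.s≤s ())
  endsIn⇒ (there (there _)) zero (ℕ.s≤s ())

  -- The left marker evolves independently of its left neighbour, which is therefore set to `rend`,
  -- the default of `at`.
  data History : List (Symbol M) → Set where
    halted : ∀ {cs} → All (Halted M) cs → History cs
    _then_ : ∀ {cs ds} → Evolves M rend cs ds → History ds → History cs

  height : ∀ {cs} → History cs → ℕ
  height (halted _) = 0
  height (_ then h) = suc (height h)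

  rowAt : ∀ {cs} → History cs → ℕ → List (Symbol M)
  rowAt {cs} _          zero    = cs
  rowAt {cs} (halted _) (suc r) = cs
  rowAt      (_ then h) (suc r) = rowAt h r

  rowAt-length : ∀ {cs} (h : History cs) r → length (rowAt h r) ≡ length cs
  rowAt-length _           zero    = refl
  rowAt-length (halted _)  (suc r) = refl
  rowAt-length (es then h) (suc r) = trans (rowAt-length h r) (evolves-length es)

  rowAt-rend : ∀ {cs} (h : History cs) → EndsWithRend cs → ∀ r → EndsWithRend (rowAt h r)
  rowAt-rend _           e zero    = e
  rowAt-rend (halted _)  e (suc r) = e
  rowAt-rend (es then h) e (suc r) = rowAt-rend h (evolves-rend es e) r

  rowAt-evolves : ∀ {cs} (h : History cs) {r} → r ℕ.< height h →
                  Evolves M rend (rowAt h r) (rowAt h (suc r))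
  rowAt-evolves (es then h) {zero}  _           = es
  rowAt-evolves (es then h) {suc r} (ℕ.s≤s r<n) = rowAt-evolves h r<n

  rowAt-halted : ∀ {cs} (h : History cs) → All (Halted M) (rowAt h (height h))
  rowAt-halted (halted hs)  = hs
  rowAt-halted (_ then h)   = rowAt-halted h

  halted-cells : ∀ as → All (Halted M) (map cell as)
  halted-cells []       = []
  halted-cells (_ ∷ as) = tt ∷ halted-cells as

  halted-row : ∀ {q a} ls rs → δ q a ≡ halt false → All (Halted M) (row M q ls a rs)
  halted-row ls rs e = tt ∷ onto ls (e ∷ Allₚ.++⁺ (halted-cells rs) (tt ∷ []))
    where
    onto : ∀ ls {cs} → All (Halted M) cs → All (Halted M) (map cell ls ʳ++ cs)
    onto []       h = h
    onto (_ ∷ ls) h = onto ls (tt ∷ h)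

  -- The number of steps of the run bounds the padding needed on either side.
  history : ∀ {q t} → Run M q t false →
            ∃ λ n → ∀ i j → n ℕ.≤ i → n ℕ.≤ j → History (rowOf M q i t j)
  history {t = tape ls a rs} (halts e) =
    0 , λ i j _ _ → halted (halted-row (padded M i ls) (padded M j rs) e)
  history {t = t} (steps e run) = let n , h = history run in
    suc n , λ i j n<i n<j →
      let i′ , j′ , n≤i′ , n≤j′ , es = rowOf-step M i t j n e n<i n<j
      in es then h i′ j′ n≤i′ n≤j′

  -- From a history to a diagram.

  module Completeness (w : List Letter) (i₀ j₀ : ℕ)
    (h : History (map (symbolOf M) (initialPhases i₀ w j₀))) where

    ps : List Phase
    ps = initialPhases i₀ w j₀

    row₀ : List (Symbol M)
    row₀ = map (symbolOf M) ps

    W : ℕ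
    W = suc (length (leftPhases i₀ w j₀))

    path : Path opening (leftPhases i₀ w j₀)
    path = path-initial i₀ w j₀

    top : ℕ
    top = height h

    onlyFirst : ℕ → Phase → Maybe Phase
    onlyFirst zero    p = just p
    onlyFirst (suc _) p = nothing

    tagRC : ℕ → ℕ → Tag M
    -- The added `rend` shifts the row by one, so position `c` yields the left neighbour.
    tagRC r c = mkTag (at rend (rend ∷ rowAt h r) c) (at rend (rowAt h r) c)
      (at rend (rowAt h r) (suc c)) (onlyFirst r (phaseAt ps c)) ⌊ r ℕₚ.≟ top ⌋

    row₀-length : length row₀ ≡ W
    row₀-length = Listₚ.length-map (symbolOf M) ps

    row-length : ∀ r → length (rowAt h r) ≡ W
    row-length r = trans (rowAt-length h r) row₀-length

    row₀-at : ∀ c → at rend row₀ c ≡ symbolOf M (phaseAt ps c)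
    row₀-at = at-map (symbolOf M) closing ps

    row₀-rend : EndsWithRend row₀
    row₀-rend = subst EndsWithRend (sym (symbols-initial M i₀ w j₀)) (endsIn⇒ (there (endsIn-++ (blanks M i₀)
      (there (endsIn-++ (letterCells M (letters⟨ prefix ⟩ ++ encode (follow w) ++ w))
        (endsIn-++ (blanks M j₀) here))))))

    inner : ∀ r c → centre (tagRC r c) ≢ rend → suc c ℕ.< W
    inner r c ne with suc c ℕₚ.<? W
    ... | yes lt = lt
    ... | no  ge = contradiction (rowAt-rend h row₀-rend r c
                     (subst (ℕ._≤ suc c) (sym (row-length r)) (ℕₚ.≮⇒≥ ge))) ne

    centred : ∀ r c → PhaseCentre M (onlyFirst r (phaseAt ps c)) (at rend (rowAt h r) c)
    centred zero    c = row₀-at c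
    centred (suc r) c = tt

    sound : ∀ r c → Sound M (tagRC r c)
    sound r c = centred r c , λ e → subst (λ r → Halted M (at rend (rowAt h r) c))
      (sym (toWitness {a? = r ℕₚ.≟ top} (subst T (sym e) tt)))
      (at-All rend (rowAt-halted h) tt c)

    phase-step : ∀ r c → suc c ℕ.< W →
                 PhaseStep M (onlyFirst r (phaseAt ps c)) (onlyFirst r (phaseAt ps (suc c)))
    phase-step zero    c (ℕ.s≤s c<) = Path-at path c c<
    phase-step (suc r) c _          = tt

    allowed-S : ∀ r c → centre (tagRC r c) ≢ rend → TagAllowed M S (tagRC r c) (tagRC r (suc c))
    allowed-S r c ne = ne , refl , refl , refl , phase-step r c (inner r c ne) , sound r (suc c)

    not-top : ∀ {r} → r ℕ.< top → final (tagRC r 0) ≡ false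
    not-top {r} r<top with r ℕₚ.≟ top
    ... | yes refl = contradiction r<top (ℕₚ.<-irrefl refl)
    ... | no  _    = refl

    not-top⁻ : ∀ {r} → r ℕ.≤ top → ⌊ r ℕₚ.≟ top ⌋ ≡ false → r ℕ.< top
    not-top⁻ {r} r≤top e with r ℕₚ.≟ top
    ... | no ne = ℕₚ.≤∧≢⇒< r≤top ne

    allowed-L : ∀ {r c} → r ℕ.< top → c ℕ.< W → TagAllowed M L (tagRC r c) (tagRC (suc r) c)
    allowed-L {r} {c} r<top c<W = not-top r<top , refl
      , evolves-at (rowAt-evolves h r<top) c (subst (c ℕ.<_) (sym (row-length r)) c<W)

    -- The rows are laid out one after another: column `c` of row `r` is node `c + r * W`.
    N : ℕ
    N = suc top * W

    tagOf : ℕ → Tag M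
    tagOf i = tagRC (i / W) (i % W)

    decompose : ∀ i → i ≡ i % W + i / W * W
    decompose i = m≡m%n+[m/n]*n i W

    located : ∀ {c} r → c ℕ.< W → (c + r * W) / W ≡ r × (c + r * W) % W ≡ c
    located {c} r c<W =
      trans (+-distrib-/-∣ʳ c (divides-refl r)) (cong₂ _+_ (m<n⇒m/n≡0 c<W) (m*n/n≡m r W))
      , trans ([m+kn]%n≡m%n c r W) (m<n⇒m%n≡m c<W)

    tag-located : ∀ {c} r → c ℕ.< W → tagOf (c + r * W) ≡ tagRC r c
    tag-located r c<W = let e , e′ = located r c<W in cong₂ tagRC e e′

    in-range : ∀ {c r} → c ℕ.< W → r ℕ.≤ top → c + r * W ℕ.< N
    in-range {c} {r} c<W r≤top = ℕₚ.<-≤-trans (ℕₚ.+-monoˡ-< (r * W) c<W)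
      (ℕₚ.*-monoˡ-≤ W (ℕ.s≤s r≤top))

    row≤top : ∀ {i} → i ℕ.< N → i / W ℕ.≤ top
    row≤top i<N = ℕ.s≤s⁻¹ (m<n*o⇒m/o<n i<N)

    suc-located : ∀ i → suc i ≡ suc (i % W) + i / W * W
    suc-located i = cong suc (decompose i)

    tag-suc : ∀ i → centre (tagOf i) ≢ rend → tagOf (suc i) ≡ tagRC (i / W) (suc (i % W))
    tag-suc i ne = trans (cong tagOf (suc-located i))
      (tag-located (i / W) (inner (i / W) (i % W) ne))

    +W-located : ∀ i → i + W ≡ i % W + suc (i / W) * W
    +W-located i = trans (cong (_+ W) (decompose i))
      (trans (ℕₚ.+-assoc (i % W) (i / W * W) W) (cong (i % W +_) (ℕₚ.+-comm (i / W * W) W)))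

    tag-+W : ∀ i → tagOf (i + W) ≡ tagRC (suc (i / W)) (i % W)
    tag-+W i = trans (cong tagOf (+W-located i)) (tag-located (suc (i / W)) (m%n<n i W))

    -- An L-link goes down one row of width `W`. Equal counts in the case `H` link each gadget to
    -- the copy with the same ordinal number.
    Link : Kind → ℕ → ℕ → Set
    Link S i j = j ≡ suc i × centre (tagOf i) ≢ rend
    Link L i j = j ≡ i + W
    Link H i j = Is-just (gadgetLetter (phase (tagOf i))) × Is-just (copyLetter (phase (tagOf j)))
               × count gadgetOf ps (i % W) ≡ count copyOf ps (j % W)

    link? : ∀ k i j → Dec (Link k i j)
    link? S i j = (j ℕₚ.≟ suc i) ×-dec ¬? (symbol-≟ M (centre (tagOf i)) rend)
    link? L i j = j ℕₚ.≟ i + W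
    link? H i j = dec (λ _ → yes tt) (gadgetLetter (phase (tagOf i)))
      ×-dec dec (λ _ → yes tt) (copyLetter (phase (tagOf j)))
      ×-dec (count gadgetOf ps (i % W) ℕₚ.≟ count copyOf ps (j % W))

    onlyFirst-inv : ∀ {f : Maybe Phase → Maybe Letter} → f nothing ≡ nothing → ∀ r p →
                    Is-just (f (onlyFirst r p)) → r ≡ 0 × Is-just (f (just p))
    onlyFirst-inv e zero    p j = refl , j
    onlyFirst-inv e (suc r) p j with () ← subst Is-just e j

    gadget-inv : ∀ i → Is-just (gadgetLetter (phase (tagOf i))) →
                 i / W ≡ 0 × Is-just (gadgetOf (phaseAt ps (i % W)))
    gadget-inv i = onlyFirst-inv {gadgetLetter} refl (i / W) (phaseAt ps (i % W))

    copy-inv : ∀ i → Is-just (copyLetter (phase (tagOf i))) →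
               i / W ≡ 0 × Is-just (copyOf (phaseAt ps (i % W)))
    copy-inv i = onlyFirst-inv {copyLetter} refl (i / W) (phaseAt ps (i % W))

    first-row : ∀ {i} → i / W ≡ 0 → i ≡ i % W
    first-row {i} e = trans (decompose i)
      (trans (cong (λ r → i % W + r * W) e) (ℕₚ.+-identityʳ (i % W)))

    gadgetAt : ∀ c {a} → gadgetOf (phaseAt ps c) ≡ just a →
               at nothing (map just w) (count gadgetOf ps c) ≡ just a
    gadgetAt c e = subst (λ v → at nothing (map just v) (count gadgetOf ps c) ≡ just _)
      (gadgets-initial i₀ w j₀) (selected gadgetOf refl ps c e)

    copyAt : ∀ c {a} → copyOf (phaseAt ps c) ≡ just a →
             at nothing (map just w) (count copyOf ps c) ≡ just a
    copyAt c e = subst (λ v → at nothing (map just v) (count copyOf ps c) ≡ just _)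
      (copies-initial i₀ w j₀) (selected copyOf refl ps c e)

    within : ∀ (f : Phase → Maybe Letter) → f closing ≡ nothing → ∀ c {a} →
             f (phaseAt ps c) ≡ just a → c ℕ.< W
    within f e c e′ = at-within closing {ps} λ closed →
      contradiction (trans (sym (trans (cong f closed) e)) e′) λ ()

    tag-first : ∀ {c} → c ℕ.< W → tagOf c ≡ tagRC 0 c
    tag-first {c} c<W = trans (cong tagOf (sym (ℕₚ.+-identityʳ c))) (tag-located 0 c<W)

    in-first : ∀ {c} → c ℕ.< W → c ℕ.< N
    in-first {c} c<W = subst (ℕ._< N) (ℕₚ.+-identityʳ c) (in-range c<W ℕ.z≤n)

    link-allowed : ∀ k {i j} → j ℕ.< N → Link k i j → TagAllowed M k (tagOf i) (tagOf j)
    link-allowed S {i} _ (refl , ne) =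
      subst (TagAllowed M S (tagOf i)) (sym (tag-suc i ne)) (allowed-S (i / W) (i % W) ne)
    link-allowed L {i} j<N refl =
      subst (TagAllowed M L (tagOf i)) (sym (tag-+W i)) (allowed-L r<top (m%n<n i W))
      where
      r<top : i / W ℕ.< top
      r<top = subst (ℕ._≤ top) (proj₁ (located (suc (i / W)) (m%n<n i W)))
        (row≤top (subst (ℕ._< N) (+W-located i) j<N))
    link-allowed H {i} {j} _ (g , k , e) = g , same
      where
      -- Both are the letter of `w` whose position is the common count.
      same : gadgetLetter (phase (tagOf i)) ≡ copyLetter (phase (tagOf j))
      same =
        let r≡0 , g′ = gadget-inv i g
            r′≡0 , k′ = copy-inv j k
            a , ga = Is-just⇒≡just g′
            b , kb = Is-just⇒≡just k′
        in trans (cong (λ r → gadgetLetter (onlyFirst r (phaseAt ps (i % W)))) r≡0)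
          (trans ga (trans (sym (gadgetAt (i % W) ga))
            (trans (cong (at nothing (map just w)) e) (trans (copyAt (j % W) kb)
              (trans (sym kb)
                (cong (λ r → copyLetter (onlyFirst r (phaseAt ps (j % W)))) (sym r′≡0)))))))

    linked-source : ∀ k {i} → i ℕ.< N → TagSrc M k (tagOf i) → ∃ λ j → j ℕ.< N × Link k i j
    linked-source S {i} i<N ne = suc i
      , subst (ℕ._< N) (sym (suc-located i))
          (in-range (inner (i / W) (i % W) ne) (row≤top i<N))
      , refl , ne
    linked-source L {i} i<N f = i + W
      , subst (ℕ._< N) (sym (+W-located i)) (in-range (m%n<n i W) (not-top⁻ (row≤top i<N) f))
      , refl
    linked-source H {i} i<N g =
      let r≡0 , g′ = gadget-inv i g
          a , ga = Is-just⇒≡just g′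
          c , kc , e = selects copyOf refl ps (count gadgetOf ps (i % W))
            (subst (λ v → at nothing (map just v) (count gadgetOf ps (i % W)) ≡ just a)
              (sym (copies-initial i₀ w j₀)) (gadgetAt (i % W) ga))
          c<W = within copyOf refl c kc
      in c , in-first c<W
       , g , subst (λ t → Is-just (copyLetter (phase t))) (sym (tag-first c<W)) (≡just⇒Is-just kc)
       , trans (sym e) (cong (count copyOf ps) (sym (m<n⇒m%n≡m c<W)))

    linked-target : ∀ k {j} → j ℕ.< N → TagTgt M k (tagOf j) → ∃ λ i → i ℕ.< N × Link k i j
    linked-target L {j} j<N e = j ∸ W , ℕₚ.≤-<-trans (ℕₚ.m∸n≤m j W) j<N
                              , sym (ℕₚ.m∸n+n≡m (below (j / W) refl e))
      where
      below : ∀ r → j / W ≡ r → onlyFirst (j / W) (phaseAt ps (j % W)) ≡ nothing → W ℕ.≤ j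
      below zero    r≡ e with () ← trans (sym (cong (λ r → onlyFirst r (phaseAt ps (j % W))) r≡)) e
      below (suc r) r≡ e = ℕₚ.≮⇒≥ λ j<W → contradiction (trans (sym (m<n⇒m/n≡0 j<W)) r≡) λ ()
    linked-target H {j} j<N k =
      let r≡0 , k′ = copy-inv j k
          a , ka = Is-just⇒≡just k′
          c , gc , e = selects gadgetOf refl ps (count copyOf ps (j % W))
            (subst (λ v → at nothing (map just v) (count copyOf ps (j % W)) ≡ just a)
              (sym (gadgets-initial i₀ w j₀)) (copyAt (j % W) ka))
          c<W = within gadgetOf refl c gc
      in c , in-first c<W
       , subst (λ t → Is-just (gadgetLetter (phase t))) (sym (tag-first c<W)) (≡just⇒Is-just gc) , k
       , trans (cong (count gadgetOf ps) (m<n⇒m%n≡m c<W)) e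

    -- For `H` all nodes lie in the first row, where a node equals its column, and counts both
    -- preserve and reflect the order of selected columns.
    linked-mono : ∀ k {i j i′ j′} → Link k i j → Link k i′ j′ → i ℕ.≤ i′ ⇔ j ℕ.≤ j′
    linked-mono S (refl , _) (refl , _) = mk⇔ ℕ.s≤s ℕ.s≤s⁻¹
    linked-mono L refl       refl       = mk⇔ (ℕₚ.+-monoˡ-≤ W) (ℕₚ.+-cancelʳ-≤ W _ _)
    linked-mono H {i} {j} {i′} {j′} (g , k , e) (g′ , k′ , e′) =
      let r , gp   = gadget-inv i g
          s , kp   = copy-inv j k
          r′ , gp′ = gadget-inv i′ g′
          s′ , kp′ = copy-inv j′ k′
      in mk⇔
        (λ le → subst₂ ℕ._≤_ (sym (first-row s)) (sym (first-row s′))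
          (count-cancel-≤ copyOf refl ps kp′ (subst₂ ℕ._≤_ e e′
            (count-mono-≤ gadgetOf refl ps gp (subst₂ ℕ._≤_ (first-row r) (first-row r′) le)))))
        (λ le → subst₂ ℕ._≤_ (sym (first-row r)) (sym (first-row r′))
          (count-cancel-≤ gadgetOf refl ps gp′ (subst₂ ℕ._≤_ (sym e) (sym e′)
            (count-mono-≤ copyOf refl ps kp (subst₂ ℕ._≤_ (first-row s) (first-row s′) le)))))

    linked-order : ∀ {i j} → i ℕ.< j → PhaseOrd M (phase (tagOf i)) (phase (tagOf j))
    linked-order {i} {j} i<j = go (i / W) (j / W) refl refl
      where
      go : ∀ r s → i / W ≡ r → j / W ≡ s →
           PhaseOrd M (onlyFirst r (phaseAt ps (i % W))) (onlyFirst s (phaseAt ps (j % W)))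
      go zero    zero    r s = Path-rank path (subst₂ ℕ._≤_ (first-row r) (first-row s) (ℕₚ.<⇒≤ i<j))
      go zero    (suc _) r s = tt
      go (suc _) _       r s = tt

    -- Written so that `suc n` computes to `N`, as `Realisation` expects nodes in `Fin (suc n)`.
    n : ℕ
    n = length (leftPhases i₀ w j₀) + top * W

    Node : Set
    Node = Fin (suc n)

    tagged : ∀ i → tagOf i ∈ tags M
    tagged i = ∈-tags M (tagOf i) (known (i / W) (i % W))
      where
      known : ∀ r c {p} → onlyFirst r (phaseAt ps c) ≡ just p → p ∈ phases
      known zero c refl = at-All closing (initial∈phases i₀ w j₀) closing∈phases c

    lab : Node → Spec.Label (spec M)
    lab u = index (tagged (toℕ u))

    lab-tag : ∀ u → tagAt M (lab u) ≡ tagOf (toℕ u)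
    lab-tag u = sym (lookup-index (tagged (toℕ u)))

    Arrow : Kind → Rel Node 0ℓ
    Arrow k u v = Link k (toℕ u) (toℕ v)

    pick : ∀ {Q : ℕ → Set} → (∃ λ i → i ℕ.< N × Q i) → ∃ λ (u : Node) → Q (toℕ u)
    pick {Q} (i , i<N , q) = Fin.fromℕ< i<N , subst Q (sym (Finₚ.toℕ-fromℕ< i<N)) q

    source : ∀ k {u} → TagSrc M k (tagAt M (lab u)) → ∃ λ v → Arrow k u v
    source k {u} s = pick (linked-source k (Finₚ.toℕ<n u) (subst (TagSrc M k) (lab-tag u) s))

    PinnedAt : Pin → Tag M → Set
    PinnedAt π t = PhasePin M π (phase t) × PhaseCentre M (phase t) (centre t)

    pinned-first : ∀ π {c} (u : Node) → toℕ u ≡ c → c ℕ.< W → PhasePin M π (just (phaseAt ps c)) →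
                   Spec.Pinned (spec M) π (lab u)
    pinned-first π {c} u refl c<W h =
      subst (PinnedAt π) (sym (trans (lab-tag u) (tag-first c<W))) (h , row₀-at c)

    data IsText : Phase → Set where
      text : ∀ b a as → IsText (text b a as)

    text≢rend : ∀ {p} → IsText p → symbolOf M p ≢ rend
    text≢rend (text _ _ _) ()

    -- Here `v` is the part of the copy still to be read behind column `c`. A text phase is not the
    -- end marker, which provides the next S-link.
    follow-copies : ∀ v {c} (u : Node) → toℕ u ≡ c → c ℕ.< W → IsText (phaseAt ps c) →
                    (∀ e → phaseAt ps (suc c + e) ≡ phaseAt (tailPhases v j₀) e) →
                    Follows (spec M) lab (Arrow S) v u
    follow-copies v {c} u refl c<W is-text onward = go v onward
      where
      ne : centre (tagRC 0 c) ≢ rend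
      ne e = text≢rend is-text (trans (sym (row₀-at c)) e)
      ne′ : centre (tagOf c) ≢ rend
      ne′ = subst (λ t → centre t ≢ rend) (sym (tag-first c<W)) ne
      next-node : ∃ λ v → Arrow S u v
      next-node = pick (linked-source S (Finₚ.toℕ<n u) ne′)
      t : Node
      t = proj₁ next-node
      t≡ : toℕ t ≡ suc c
      t≡ = proj₁ (proj₂ next-node)
      sc<W : suc c ℕ.< W
      sc<W = inner 0 c ne
      pin-next : ∀ π {v} → (∀ e → phaseAt ps (suc c + e) ≡ phaseAt (tailPhases v j₀) e) →
                 PhasePin M π (just (phaseAt (tailPhases v j₀) 0)) → Spec.Pinned (spec M) π (lab t)
      pin-next π on h = pinned-first π t t≡ sc<W
        (subst (PhasePin M π ∘ just) (sym (trans (cong (phaseAt ps) (sym (ℕₚ.+-identityʳ (suc c)))) (on 0))) h)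
      finishing : ∀ j → rank (phaseAt (rightPhases j) 0) ≡ 4
      finishing zero    = refl
      finishing (suc j) = refl
      go : ∀ v → (∀ e → phaseAt ps (suc c + e) ≡ phaseAt (tailPhases v j₀) e) →
           Follows (spec M) lab (Arrow S) v u
      go []      on = t , proj₂ next-node , pin-next finish {[]} on (finishing j₀)
      go (a ∷ v) on = t , proj₂ next-node , pin-next (letter a) {a ∷ v} on refl
        , follow-copies v t t≡ sc<W
            (subst IsText (sym (trans (cong (phaseAt ps) (sym (ℕₚ.+-identityʳ (suc c)))) (on 0))) (text (copy a) a []))
            (λ e → trans (cong (phaseAt ps) (sym (ℕₚ.+-suc (suc c) e))) (on (suc e)))

    diagram : Diagram (spec M) {Node} Fin._≤_ w
    diagram = record
      { lab       = lab
      ; Arrow     = Arrow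
      ; allowed   = λ k {u} {v} r → subst₂ (TagAllowed M k) (sym (lab-tag u)) (sym (lab-tag v))
                      (link-allowed k (Finₚ.toℕ<n v) r)
      ; source    = source
      ; target    = λ k {v} h →
                      pick (linked-target k (Finₚ.toℕ<n v) (subst (TagTgt M k) (lab-tag v) h))
      ; mono      = λ k → linked-mono k
      ; immediate = λ { {u} t (e , _) → mk⇔
                      (λ v≤t → ℕₚ.<⇒≱ (subst (ℕ._≤ toℕ t) e v≤t))
                      (λ t≰u → subst (ℕ._≤ toℕ t) (sym e) (ℕₚ.≰⇒> t≰u)) }
      ; ordered   = λ {u} {v} v≰u → subst₂ (λ s t → PhaseOrd M (phase s) (phase t))
                      (sym (lab-tag u)) (sym (lab-tag v)) (linked-order (ℕₚ.≰⇒> v≰u))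
      ; hasOrigin = Fin.zero , pinned-first origin Fin.zero refl (ℕ.s≤s ℕ.z≤n) refl
      ; hasTurn   = turnNode
      ; follows   = turned
      }
      where
      turnAt : ∃ (IsTurn ∘ phaseAt ps)
      turnAt = TurnBefore.turning (turn-initial i₀ w j₀)
      turn<W : ∀ c → IsTurn (phaseAt ps c) → c ℕ.< W
      turn<W c h = at-within closing {ps} λ e → subst IsTurn e h
      turn⇒pin : ∀ {p} → IsTurn p → PhasePin M turn (just p)
      turn⇒pin {text pivot _ []} _ = tt
      turnNode : ∃ λ u → Spec.Pinned (spec M) turn (lab u)
      turnNode =
        let k , h = turnAt
            k<N = in-first (turn<W k h)
        in Fin.fromℕ< k<N , pinned-first turn (Fin.fromℕ< k<N) (Finₚ.toℕ-fromℕ< k<N) (turn<W k h) (turn⇒pin h)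
      turned : ∀ {u} → Spec.Pinned (spec M) turn (lab u) → Follows (spec M) lab (Arrow S) w u
      -- Phases occur in row 0 only, so a turn node lies there.
      turned {u} (h , _) = found (toℕ u / W) refl (subst (PhasePin M turn ∘ phase) (lab-tag u) h)
        where
        pin⇒turn : ∀ {p} → PhasePin M turn (just p) → IsTurn p
        pin⇒turn {text pivot _ []} _ = tt
        turn⇒text : ∀ {p} → IsTurn p → IsText p
        turn⇒text {text pivot z []} _ = text pivot z []
        found : ∀ r → toℕ u / W ≡ r → PhasePin M turn (onlyFirst (toℕ u / W) (phaseAt ps (toℕ u % W))) →
                Follows (spec M) lab (Arrow S) w u
        found zero e p =
          let t = pin⇒turn (subst (λ r → PhasePin M turn (onlyFirst r (phaseAt ps (toℕ u % W)))) e p)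
          in follow-copies w u (first-row e) (m%n<n (toℕ u) W) (turn⇒text t)
               (TurnBefore.onward (turn-initial i₀ w j₀) (toℕ u % W) t)
        found (suc r) e p =
          ⊥-elim (subst (λ r → PhasePin M turn (onlyFirst r (phaseAt ps (toℕ u % W)))) e p)

-- The machine confronted with its own sentence.

module _ (M : TuringMachine) where
  open TuringMachine M

  realised : ∀ n → let w = encode (Spec.body (spec M)) in
             History M (map (symbolOf M) (initialPhases n w n)) → FinitelySatisfiable (φ M)
  realised n h = Realisation.satisfiable (spec M) C.diagram (λ k u v → C.link? k (toℕ u) (toℕ v))
    where module C = Completeness M (encode (Spec.body (spec M))) n n h

  first-history : ∀ w → Run M start (initial M (univ ∷ letters⟨ prefix ⟩ ++ encode (follow w) ++ w)) false →
                  ∃ λ n → History M (map (symbolOf M) (initialPhases n w n))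
  first-history w run =
    let n , h = history M run
    in n , subst (History M)
             (trans (rowOf-initial M n univ (letters⟨ prefix ⟩ ++ encode (follow w) ++ w) n)
               (sym (symbols-initial M n w n)))
             (h n n ℕₚ.≤-refl ℕₚ.≤-refl)

  rejects⇒satisfiable : HaltsWith M (encode (proj₁ (φ M))) false → FinitelySatisfiable (φ M)
  rejects⇒satisfiable run =
    let n , h = first-history (encode (Spec.body (spec M))) run in realised n h

theorem4p2 : Undecidable FinitelySatisfiable
theorem4p2 (M , decides) = refute (decides (φ M))
  where
  refute : (∃ λ b → HaltsWith M (encode (proj₁ (φ M))) b × (b ≡ true ⇔ FinitelySatisfiable (φ M))) → ⊥
  -- The answer `true` promises a model, which rules out an accepting run. The answer `false`
  -- produces a model, for which the answer should have been `true`.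
  refute (true  , run , iff′) = satisfiable⇒¬accepts M (to iff′ refl) run
  refute (false , run , iff′) = contradiction (from iff′ (rejects⇒satisfiable M run)) λ ()
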